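{- Let $0\le K<N$ be integers and let $S$ be a 2-string with $|S|=2K$. Let $\bm{u}=(u_1,\dots,u_{N-K})$, let $\bm{u}\cup\bm{z}=(u_1,\dots,u_{N-K},z_1,z_2,\dots)$, and let $2^{N-K}\cup S=(2,\dots,2,S_1,S_2,\dots)$ with $N-K$ initial twos. Then, for an arbitrary choice of the alphabet $(w_1,\dots,w_{N-K})$, $$\lim_{u_1\to\infty}\cdots\lim_{u_{N-K}\to\infty}\frac{F_{2^{N-K}\cup S}(x_1,\dots,x_N;\bm{u}\cup\bm{z})}{F_{(2^{N-K})}(w_1,\dots,w_{N-K};\bm{u})}=H_S(x_1,\dots,x_N;\bm{z}).$$
   Context: **Weights.** All parameters ($q$ and the spectral parameters) are generic/indeterminates. For $i,j,k,\ell\in\{0,1,2\}$ the Izergin--Korepin vertex weight $W_{y/x}(i,j;k,\ell)$ ($i$ = bottom incoming state, $j$ = left incoming state, $k$ = top outgoing state, $\ell$ = right outgoing state; $x$ = parameter of the horizontal line, $y$ = parameter of the vertical line) depends on $x,y$ only through $y/x$, and, with $D=(x-q^2y)(x-q^3y)$, is given by $W(0,0;0,0)=W(2,2;2,2)=1$; $W(1,0;1,0)=W(2,1;2,1)=\frac{q^2(x-y)}{x-q^2y}$; $W(1,0;0,1)=W(2,1;1,2)=\frac{(1-q^2)x}{x-q^2y}$; $W(0,1;1,0)=W(1,2;2,1)=\frac{(1-q^2)y}{x-q^2y}$; $W(0,1;0,1)=W(1,2;1,2)=\frac{x-y}{x-q^2y}$; $W(2,0;2,0)=\frac{q^4(x-y)(x-qy)}{D}$;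 $W(2,0;1,1)=-\frac{q(1-q)^2(1+q)x(x-y)}{D}$; $W(2,0;0,2)=\frac{(1-q^2)x(x+qx-qy-q^3y)}{D}$; $W(1,1;2,0)=-\frac{q^4(1+q)(x-y)y}{D}$; $W(1,1;1,1)=\frac{ -qx^2+(1+q)(1-q^2+q^4)xy-q^4y^2}{D}$; $W(1,1;0,2)=\frac{(1+q)x(x-y)}{D}$; $W(0,2;2,0)=\frac{(1-q^2)(x+q^2x-q^2y-q^3y)y}{D}$; $W(0,2;1,1)=\frac{q(1-q)^2(1+q)(x-y)y}{D}$; $W(0,2;0,2)=\frac{(x-y)(x-qy)}{D}$; and $W=0$ in all other cases. **2-strings.** A 2-string is an infinite vector $S=(S_1,S_2,\dots)$ with $S_i\in\{0,1,2\}$ and only finitely many nonzero entries; $|S|=\sum_i S_i$. Trailing zeros may be dropped; $(2^n)$ denotes $n$ twos followed by zeros. $\bm{z}=(z_1,z_2,\dots)$. **$F_S^I$ and $F_S$.** For $I=(I_1,\dots,I_N)\in\{0,1,2\}^N$ with $|I|=\sum_r I_r=|S|$, choose $L$ with $S_c=0$ for $c>L$ and put $$F_S^I(x_1,\dots,x_N;\bm{z})=\sum\prod_{r=1}^{N}\prod_{c=1}^{L}W_{z_c/x_r}(v_{r-1,c},h_{r,c-1};v_{r,c},h_{r,c}),$$ summed over all $h_{r,c}\in\{0,1,2\}$ ($1\le r\le N$, $0\le c\le L$) and $v_{r,c}\in\{0,1,2\}$ ($0\le r\le N$, $1\le c\le L$) with $h_{r,0}=I_r$, $h_{r,L}=0$,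 $v_{0,c}=0$, $v_{N,c}=S_c$ (independent of $L$; it depends only on $z_1,\dots,z_L$). For $|S|=2N$, $F_S:=F_S^{(2^N)}$. **$H_S$.** For $0\le K\le N$ and $|S|=2K$, $$H_S(x_1,\dots,x_N;\bm{z})=\sum_{I\in\{0,1,2\}^N:\,|I|=2K}(-1)^{\mathfrak{c}_1(I)/2}(1-q^{ -1})^{\mathfrak{c}_1(I)}q^{ -\mathrm{inv}(I)}F_S^I(x_1,\dots,x_N;\bm{z}),$$ where $\mathfrak{c}_1(I)=\#\{r:I_r=1\}$ and $\mathrm{inv}(I)=\sum_{1\le i<j\le N}I_i(2-I_j)$. -}

module Defs where

open import Algebra.Bundles using (CommutativeRing)
import Algebra.Properties.CommutativeMonoid.Sum as Sum
import Algebra.Properties.Semiring.Exp as Exp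
open import Data.Fin using (Fin; toℕ; inject₁)
  renaming (zero to fzero; suc to fsuc)
open import Data.Fin.Patterns using (0F; 1F; 2F)
import Data.Fin.Properties as Fin
open import Data.List as List using (List)
open import Data.Nat as ℕ using (ℕ; zero; suc; _∸_; ⌊_/2⌋)
import Data.Nat.Properties as ℕ
open import Data.Product using (_×_; _,_; ∃-syntax)
open import Data.Vec as Vec using (Vec; []; _∷_)
import Data.Vec.Properties as Vec
open import Level using (Lift; _⊔_) renaming (suc to lsuc)
open import Relation.Binary using (IsStrictTotalOrder)
open import Relation.Binary.PropositionalEquality using (_≡_; refl)
open import Relation.Nullary using (¬_; Dec; _×-dec_)

-- The value of 0# ⁻¹ is left unspecified.
record Field c ℓ : Set (lsuc (c ⊔ ℓ)) where
  infix  9 _⁻¹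
  infixl 7 _/_
  field
    commutativeRing : CommutativeRing c ℓ
  open CommutativeRing commutativeRing public
  open Exp semiring public using (_^_)
  field
    _⁻¹       : Carrier → Carrier
    ⁻¹-cong   : ∀ {x y} → x ≈ y → x ⁻¹ ≈ y ⁻¹
    *-inverse : ∀ {x} → x ≉ 0# → x * x ⁻¹ ≈ 1#
    1≉0       : 1# ≉ 0#

  _/_ : Carrier → Carrier → Carrier
  x / y = x * y ⁻¹

record OrderedField c ℓ₁ ℓ₂ : Set (lsuc (c ⊔ ℓ₁ ⊔ ℓ₂)) where
  infix 4 _<_
  field
    underlyingField : Field c ℓ₁
  open Field underlyingField public
  field
    _<_                : Carrier → Carrier → Set ℓ₂
    isStrictTotalOrder : IsStrictTotalOrder _≈_ _<_
    +-monoˡ-<          : ∀ {x y} z → x < y → x + z < y + z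
    *-pos              : ∀ {x y} → 0# < x → 0# < y → 0# < x * y

-- A field with an absolute value taking values in an ordered field, for
-- example ℝ or ℂ.  Unboundedness makes limits at infinity unique.
record ValuedField c ℓ r ρ₁ ρ₂ : Set (lsuc (c ⊔ ℓ ⊔ r ⊔ ρ₁ ⊔ ρ₂)) where
  field
    scalars : Field c ℓ
    values  : OrderedField r ρ₁ ρ₂
  open Field scalars public
  module R = OrderedField values
  field
    ∣_∣       : Carrier → R.Carrier
    ∣∣-cong   : ∀ {x y} → x ≈ y → ∣ x ∣ R.≈ ∣ y ∣
    ∣0∣       : ∣ 0# ∣ R.≈ R.0#
    ∣∣-pos    : ∀ {x} → x ≉ 0# → R.0# R.< ∣ x ∣
    ∣∣-*      : ∀ x y → ∣ x * y ∣ R.≈ ∣ x ∣ R.* ∣ y ∣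
    triangle  : ∀ x y → ¬ (∣ x ∣ R.+ ∣ y ∣ R.< ∣ x + y ∣)
    unbounded : ∀ b → ∃[ x ] (b R.< ∣ x ∣)

module Limits {c ℓ r ρ₁ ρ₂} (V : ValuedField c ℓ r ρ₁ ρ₂) where
  open ValuedField V

  Eventually : ∀ {p} → (Carrier → Set p) → Set (c ⊔ r ⊔ ρ₂ ⊔ p)
  Eventually P = ∃[ B ] (∀ u → B R.< ∣ u ∣ → P u)

  -- lim_{u → ∞} f u = a
  Limit : (Carrier → Carrier) → Carrier → Set (c ⊔ r ⊔ ρ₂)
  Limit f a = ∀ ε → R.0# R.< ε → Eventually (λ u → ∣ f u - a ∣ R.< ε)

  -- lim_{u₁ → ∞} ⋯ lim_{uₙ → ∞} f (u₁ , … , uₙ) = a: the limit in uₙ is taken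
  -- first, and the limits in u₂ , … , uₙ need only exist for large u₁.
  IteratedLimit : ∀ n → (Vec Carrier n → Carrier) → Carrier →
                  Set (c ⊔ ℓ ⊔ r ⊔ ρ₂)
  IteratedLimit zero    f a = Lift (c ⊔ r ⊔ ρ₂) (f [] ≈ a)
  IteratedLimit (suc n) f a =
    ∃[ g ] (Eventually (λ u → IteratedLimit n (λ us → f (u ∷ us)) (g u))
            × Limit g a)

State : Set
State = Fin 3

infixr 5 _∪_

-- (a₁ , … , aₙ) ∪ (b₁ , b₂ , …) = (a₁ , … , aₙ , b₁ , b₂ , …)
_∪_ : ∀ {a} {A : Set a} {n} → Vec A n → (ℕ → A) → (ℕ → A)
([]       ∪ b) k       = b k
((x ∷ xs) ∪ b) zero    = x
((x ∷ xs) ∪ b) (suc k) = (xs ∪ b) k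

prefix : ∀ {a} {A : Set a} n → (ℕ → A) → Vec A n
prefix n f = Vec.tabulate (λ c → f (toℕ {n} c))

∣_∣ᵥ : ∀ {n} → Vec State n → ℕ
∣ I ∣ᵥ = Vec.sum (Vec.map toℕ I)

-- Entries are indexed from 0; bound is any L beyond which they all vanish.
record TwoString : Set where
  field
    entry    : ℕ → State
    bound    : ℕ
    vanishes : ∀ c → bound ℕ.≤ c → entry c ≡ 0F

open TwoString public

∣_∣ₛ : TwoString → ℕ
∣ S ∣ₛ = ∣ prefix (bound S) (entry S) ∣ᵥ

twos : ∀ n → Vec State n
twos n = Vec.replicate n 2F

infixr 5 2^_∪_

2^_∪_ : ℕ → TwoString → TwoString
2^ n ∪ S = record
  { entry    = twos n ∪ entry S
  ; bound    = n ℕ.+ bound S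
  ; vanishes = vanish n
  }
  where
  vanish : ∀ n c → n ℕ.+ bound S ℕ.≤ c → (twos n ∪ entry S) c ≡ 0F
  vanish zero    c       p         = vanishes S c p
  vanish (suc n) (suc c) (ℕ.s≤s p) = vanish n c p

∅ : TwoString
∅ = record { entry = λ _ → 0F ; bound = 0 ; vanishes = λ _ _ → refl }

vectors : ∀ {a} {A : Set a} → List A → ∀ n → List (Vec A n)
vectors as zero    = List.[ [] ]
vectors as (suc n) = List.cartesianProductWith _∷_ as (vectors as n)

words : ∀ n → List (Vec State n)
words = vectors (List.allFin 3)

-- The labels h r c of the horizontal edges and v r c of the vertical edges of
-- an N × L lattice, one row per inner vector.
Configuration : ℕ → ℕ → Set
Configuration N L = Vec (Vec State (suc L)) N × Vec (Vec State L) (suc N)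

configurations : ∀ N L → List (Configuration N L)
configurations N L =
  List.cartesianProduct (vectors (words (suc L)) N) (vectors (words L) (suc N))

HasBoundary : ∀ {N L} → Vec State N → Vec State L → Configuration N L → Set
HasBoundary {N} {L} I S (h , v) =
  (Vec.map Vec.head h ≡ I × Vec.map Vec.last h ≡ Vec.replicate N 0F) ×
  (Vec.head v ≡ Vec.replicate L 0F × Vec.last v ≡ S)

infix 4 _≟ᵥ_

_≟ᵥ_ : ∀ {n} (I J : Vec State n) → Dec (I ≡ J)
_≟ᵥ_ = Vec.≡-dec Fin._≟_

hasBoundary? : ∀ {N L} I S (C : Configuration N L) → Dec (HasBoundary I S C)
hasBoundary? {N} {L} I S (h , v) =
  (Vec.map Vec.head h ≟ᵥ I ×-dec Vec.map Vec.last h ≟ᵥ Vec.replicate N 0F) ×-dec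
  (Vec.head v ≟ᵥ Vec.replicate L 0F ×-dec Vec.last v ≟ᵥ S)

𝔠₁ : ∀ {n} → Vec State n → ℕ
𝔠₁ = Vec.count (Fin._≟ 1F)

-- ∑_{i < j} Iᵢ (2 − Iⱼ)
inv : ∀ {n} → Vec State n → ℕ
inv []      = 0
inv (i ∷ I) = Vec.sum (Vec.map (λ j → toℕ i ℕ.* (2 ∸ toℕ j)) I) ℕ.+ inv I

module IzerginKorepin {c ℓ} (𝔽 : Field c ℓ) (q : Field.Carrier 𝔽) where
  open Field 𝔽

  open Sum *-commutativeMonoid using () renaming (sum to ∏)

  ∑ : ∀ {a} {A : Set a} → List A → (A → Carrier) → Carrier
  ∑ as f = List.foldr (λ a s → f a + s) 0# as

  -- W x y i j k l is W_{y/x}(i, j; k, l).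
  W : (x y : Carrier) (i j k l : State) → Carrier
  W x y = weight
    where
    d D : Carrier
    d = x - q ^ 2 * y
    D = (x - q ^ 2 * y) * (x - q ^ 3 * y)

    weight : (i j k l : State) → Carrier
    weight 0F 0F 0F 0F = 1#
    weight 2F 2F 2F 2F = 1#
    weight 1F 0F 1F 0F = q ^ 2 * (x - y) / d
    weight 2F 1F 2F 1F = q ^ 2 * (x - y) / d
    weight 1F 0F 0F 1F = (1# - q ^ 2) * x / d
    weight 2F 1F 1F 2F = (1# - q ^ 2) * x / d
    weight 0F 1F 1F 0F = (1# - q ^ 2) * y / d
    weight 1F 2F 2F 1F = (1# - q ^ 2) * y / d
    weight 0F 1F 0F 1F = (x - y) / d
    weight 1F 2F 1F 2F = (x - y) / d
    weight 2F 0F 2F 0F = q ^ 4 * (x - y) * (x - q * y) / D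
    weight 2F 0F 1F 1F = - (q * (1# - q) ^ 2 * (1# + q) * x * (x - y)) / D
    weight 2F 0F 0F 2F =
      (1# - q ^ 2) * x * (x + q * x - q * y - q ^ 3 * y) / D
    weight 1F 1F 2F 0F = - (q ^ 4 * (1# + q) * (x - y) * y) / D
    weight 1F 1F 1F 1F =
      (- (q * x ^ 2) + (1# + q) * (1# - q ^ 2 + q ^ 4) * x * y - q ^ 4 * y ^ 2)
      / D
    weight 1F 1F 0F 2F = (1# + q) * x * (x - y) / D
    weight 0F 2F 2F 0F =
      (1# - q ^ 2) * (x + q ^ 2 * x - q ^ 2 * y - q ^ 3 * y) * y / D
    weight 0F 2F 1F 1F = q * (1# - q) ^ 2 * (1# + q) * (x - y) * y / D
    weight 0F 2F 0F 2F = (x - y) * (x - q * y) / D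
    weight _  _  _  _  = 0#

  configurationWeight : ∀ {N L} → Vec Carrier N → Vec Carrier L →
                        Configuration N L → Carrier
  configurationWeight x z (h , v) =
    ∏ λ r → ∏ λ c →
      W (Vec.lookup x r) (Vec.lookup z c)
        (Vec.lookup (Vec.lookup v (inject₁ r)) c)
        (Vec.lookup (Vec.lookup h r) (inject₁ c))
        (Vec.lookup (Vec.lookup v (fsuc r)) c)
        (Vec.lookup (Vec.lookup h r) (fsuc c))

  -- Fᴵ I S x z is F_S^I(x; z).
  Fᴵ : ∀ {N} → Vec State N → TwoString → Vec Carrier N → (ℕ → Carrier) → Carrier
  Fᴵ {N} I S x z =
    ∑ (List.filter (hasBoundary? I (prefix L (entry S))) (configurations N L))
      (configurationWeight x (prefix L z))
    where
    L : ℕ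
    L = bound S

  -- Only the first bound S entries of z matter: F (2^ n ∪ ∅) w (u ∪ z), with u
  -- of length n, is F_{(2ⁿ)}(w; u).
  F : ∀ {N} → TwoString → Vec Carrier N → (ℕ → Carrier) → Carrier
  F {N} = Fᴵ (twos N)

  -- K is such that |S| = 2K.
  H : ∀ {N} (K : ℕ) → TwoString → Vec Carrier N → (ℕ → Carrier) → Carrier
  H {N} K S x z =
    ∑ (List.filter (λ I → ∣ I ∣ᵥ ℕ.≟ 2 ℕ.* K) (words N)) λ I →
      (- 1#) ^ ⌊ 𝔠₁ I /2⌋ * (1# - q ⁻¹) ^ 𝔠₁ I * (q ⁻¹) ^ inv I * Fᴵ I S x z

  -- Satisfied by indeterminates; the last two conditions say that the
  -- denominators of the weights do not vanish.
  record Generic {N} (x : Vec Carrier N) (z : ℕ → Carrier) : Set ℓ where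
    field
      q≉0      : q ≉ 0#
      qᵏ≉1     : ∀ k → q ^ suc k ≉ 1#
      x≉q²z    : ∀ r c → Vec.lookup x r ≉ q ^ 2 * z c
      x≉q³z    : ∀ r c → Vec.lookup x r ≉ q ^ 3 * z c

{-# OPTIONS --safe #-}
module Submission where

-- The weights W_{y/x} are homogeneous of degree 0 in (x , y), so as u → ∞ the
-- weight W_{u/x} tends to the weight at (x , y) = (0 , 1), which no longer
-- depends on x (limit-W).  F is a finite sum of products of weights, each of
-- which involves at most one of the variables u_c, so the iterated limit of
-- F_{2ⁿ ∪ S}(x; u ∪ z) exists and is the partition function in which the first n
-- columns carry the weights at infinity (iterated-F).
--
-- This partition function is evaluated one column at a time.  Its first column
-- acts on the left boundary as a transfer matrix (partition-∷).  Let Q = q⁻¹, let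
-- d(I) = ∑ᵣ (2 − Iᵣ) and X_I = (−Q)^d(I), and let h(I) be the coefficient of F_S^I
-- in H_S.  For the weight T_a(I , J) of a column at infinity with bottom label a,
-- top label 2, left labels I and right labels J, the key fact (column-identity) is
--
--   ∑_I h(I) T_a(I , J) = γ_a(X_J) h(J),
--   γ₂(X) = 1,  γ₁(X) = 1 − X,  γ₀(X) = (1 − X)(1 + qX).
--
-- It is proved by induction on the rows.  The coefficient h is multiplicative
-- along the rows, h(i , I) = ε_i X_I^i h(I) with ε = (1 , 1 − Q , 1)
-- (coefficient-∷), and conservation of labels in the vertices expresses X_I
-- through X_J (X-balance); what remains are nine polynomial identities for a
-- single vertex, one for each bottom label and right label (vertex-identity).
--
-- Consequently, removing a column at infinity multiplies the sum of
-- h(I) × (partition function with left boundary I) over |I| = 2K by a constant that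
-- depends only on d(J) = 2(N − K) (Hsum-column).  For K = N the sum has the single
-- term I = 2^N and is the limit of F; once all n = N − K columns at infinity are
-- gone, it is H_S.  So the limit of F_{2ⁿ ∪ S} is C H_S, where C depends on n and q
-- only (partition-infinities).  The same applies to F_{2ⁿ}, where H_∅ = 1 (H-∅),
-- and C ≠ 0 because q is neither 0 nor a root of unity (norm≉0); hence the quotient
-- tends to H_S.

open import Defs
open import Algebra.Bundles using (CommutativeRing; RawRing)
import Algebra.Properties.CommutativeMonoid.Sum as Sum
import Algebra.Properties.CommutativeSemigroup as CommutativeSemigroupProperties
import Algebra.Properties.Ring as RingProperties
import Algebra.Properties.Semiring.Exp as Exp
import Algebra.Properties.Semiring.Mult.TCOptimised as Mult
import Algebra.Solver.Ring as RingSolver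
open import Algebra.Solver.Ring.AlmostCommutativeRing
  using (fromCommutativeRing; _-Raw-AlmostCommutative⟶_)
open import Data.Bool using (if_then_else_; true; false)
open import Data.Fin using (Fin; toℕ; opposite; inject₁)
  renaming (zero to fzero; suc to fsuc)
open import Data.Fin.Patterns using (0F; 1F; 2F)
import Data.Fin.Properties as Fin
import Data.Integer as ℤ
import Data.Integer.Properties as ℤ
open import Data.List as List using (List)
open import Data.Maybe as Maybe using (Maybe)
open import Data.Nat as ℕ using (ℕ; zero; suc; _∸_; ⌊_/2⌋)
import Data.Nat.Properties as ℕ
open import Data.Product using (_×_; _,_; ∃-syntax; proj₁; proj₂)
import Data.Sign as Sign
open import Data.Vec as Vec using (Vec; []; _∷_; lookup; zipWith)
import Data.Vec.Properties as Vec
open import Function using (_∘_)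
open import Level using (Level; lift)
open import Relation.Binary using (IsStrictTotalOrder; tri<; tri≈; tri>)
open import Relation.Binary.PropositionalEquality as ≡ using (_≡_; _≢_)
import Relation.Binary.Reasoning.Setoid as SetoidReasoning
open import Relation.Nullary
  using (¬_; Dec; yes; no; does; contradiction; _×-dec_)
open import Relation.Nullary.Decidable using (dec-true; dec-false; dec⇒maybe)

-- Polynomial identities in commutative rings

-- The ring solver with integer coefficients, mapped to the ring by the unique
-- homomorphism from ℤ.
module IntegerCoefficients {c ℓ} (R : CommutativeRing c ℓ) where
  open CommutativeRing R
  open Mult semiring using (1+×; ×-homo-+; ×1-homo-*)
    renaming (_×_ to infixl 8 _·_)
  open RingProperties ring
  open SetoidReasoning setoid

  fromℤ : ℤ.ℤ → Carrier
  fromℤ (ℤ.+ n)      = n · 1#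
  fromℤ ℤ.-[1+ n ]   = - (suc n · 1#)

  fromSign : Sign.Sign → Carrier
  fromSign Sign.+ = 1#
  fromSign Sign.- = - 1#

  fromℤ-neg : ∀ i → fromℤ (ℤ.- i) ≈ - fromℤ i
  fromℤ-neg (ℤ.+ zero)  = sym -0#≈0#
  fromℤ-neg (ℤ.+ suc n) = refl
  fromℤ-neg ℤ.-[1+ n ]  = sym (-‿involutive _)

  cancel-1# : ∀ a b → (1# + a) - (1# + b) ≈ a - b
  cancel-1# a b = begin
    (1# + a) - (1# + b)     ≈⟨ +-cong (+-comm 1# a) (sym (-‿+-comm 1# b)) ⟩
    (a + 1#) + (- 1# - b)   ≈⟨ +-assoc a 1# _ ⟩
    a + (1# + (- 1# - b))   ≈⟨ +-congˡ (sym (+-assoc 1# (- 1#) (- b))) ⟩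
    a + ((1# - 1#) - b)     ≈⟨ +-congˡ (+-congʳ (-‿inverseʳ 1#)) ⟩
    a + (0# - b)            ≈⟨ +-congˡ (+-identityˡ _) ⟩
    a - b                   ∎

  fromℤ-⊖ : ∀ m n → fromℤ (m ℤ.⊖ n) ≈ m · 1# - n · 1#
  fromℤ-⊖ m       zero    = sym (trans (+-congˡ -0#≈0#) (+-identityʳ _))
  fromℤ-⊖ zero    (suc n) = sym (+-identityˡ _)
  fromℤ-⊖ (suc m) (suc n) = begin
    fromℤ (suc m ℤ.⊖ suc n)          ≡⟨ ≡.cong fromℤ (ℤ.[1+m]⊖[1+n]≡m⊖n m n) ⟩
    fromℤ (m ℤ.⊖ n)                  ≈⟨ fromℤ-⊖ m n ⟩
    m · 1# - n · 1#                  ≈⟨ sym (cancel-1# _ _) ⟩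
    (1# + m · 1#) - (1# + n · 1#)    ≈⟨ +-cong (sym (1+× m 1#)) (-‿cong (sym (1+× n 1#))) ⟩
    suc m · 1# - suc n · 1#          ∎

  fromℤ-+ : ∀ i j → fromℤ (i ℤ.+ j) ≈ fromℤ i + fromℤ j
  fromℤ-+ (ℤ.+ m)    (ℤ.+ n)    = ×-homo-+ 1# m n
  fromℤ-+ (ℤ.+ m)    ℤ.-[1+ n ] = fromℤ-⊖ m (suc n)
  fromℤ-+ ℤ.-[1+ m ] (ℤ.+ n)    = trans (fromℤ-⊖ n (suc m)) (+-comm _ _)
  fromℤ-+ ℤ.-[1+ m ] ℤ.-[1+ n ] = begin
    - (suc (suc (m ℕ.+ n)) · 1#)         ≡⟨ ≡.cong (λ k → - (suc k · 1#)) (≡.sym (ℕ.+-suc m n)) ⟩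
    - ((suc m ℕ.+ suc n) · 1#)           ≈⟨ -‿cong (×-homo-+ 1# (suc m) (suc n)) ⟩
    - (suc m · 1# + suc n · 1#)          ≈⟨ sym (-‿+-comm _ _) ⟩
    - (suc m · 1#) + - (suc n · 1#)      ∎

  fromℤ-◃ : ∀ s n → fromℤ (s ℤ.◃ n) ≈ fromSign s * (n · 1#)
  fromℤ-◃ s      zero    = sym (zeroʳ _)
  fromℤ-◃ Sign.+ (suc n) = sym (*-identityˡ _)
  fromℤ-◃ Sign.- (suc n) = sym (-1*x≈-x _)

  fromSign-* : ∀ s t → fromSign (s Sign.* t) ≈ fromSign s * fromSign t
  fromSign-* Sign.+ t      = sym (*-identityˡ _)
  fromSign-* Sign.- Sign.+ = sym (*-identityʳ _)
  fromSign-* Sign.- Sign.- = sym (trans (-1*x≈-x _) (-‿involutive 1#))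

  fromℤ-* : ∀ i j → fromℤ (i ℤ.* j) ≈ fromℤ i * fromℤ j
  fromℤ-* i j = begin
    fromℤ (i ℤ.* j)
      ≈⟨ fromℤ-◃ (s Sign.* t) (m ℕ.* n) ⟩
    fromSign (s Sign.* t) * ((m ℕ.* n) · 1#)
      ≈⟨ *-cong (fromSign-* s t) (×1-homo-* m n) ⟩
    (fromSign s * fromSign t) * ((m · 1#) * (n · 1#))
      ≈⟨ interchange _ _ _ _ ⟩
    (fromSign s * (m · 1#)) * (fromSign t * (n · 1#))
      ≈⟨ *-cong (sym (fromℤ-◃ s m)) (sym (fromℤ-◃ t n)) ⟩
    fromℤ (s ℤ.◃ m) * fromℤ (t ℤ.◃ n)
      ≡⟨ ≡.cong₂ (λ k l → fromℤ k * fromℤ l) (ℤ.signᵢ◃∣i∣≡i i) (ℤ.signᵢ◃∣i∣≡i j) ⟩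
    fromℤ i * fromℤ j ∎
    where
    open CommutativeSemigroupProperties *-commutativeSemigroup
      using (interchange)
    s = ℤ.sign i
    t = ℤ.sign j
    m = ℤ.∣ i ∣
    n = ℤ.∣ j ∣

  homomorphism : ℤ.+-*-rawRing -Raw-AlmostCommutative⟶ fromCommutativeRing R
  homomorphism = record
    { ⟦_⟧    = fromℤ
    ; +-homo = fromℤ-+
    ; *-homo = fromℤ-*
    ; -‿homo = fromℤ-neg
    ; 0-homo = refl
    ; 1-homo = refl
    }

  private
    _coeff≟_ : ∀ i j → Maybe (fromℤ i ≈ fromℤ j)
    i coeff≟ j = Maybe.map (λ eq → reflexive (≡.cong fromℤ eq)) (dec⇒maybe (i ℤ.≟ j))

  open RingSolver ℤ.+-*-rawRing (fromCommutativeRing R) homomorphism _coeff≟_ public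
    using (Polynomial; solve; con; _:=_; _:+_; _:*_; _:-_; :-_; _:^_)

  𝟘 𝟙 : ∀ {n} → Polynomial n
  𝟘 = con (ℤ.+ 0)
  𝟙 = con (ℤ.+ 1)

-- Fields and ordered fields

module FieldProperties {c ℓ} (𝔽 : Field c ℓ) where
  open Field 𝔽
  open IntegerCoefficients commutativeRing
  open SetoidReasoning setoid

  *-inverseˡ : ∀ {x} → x ≉ 0# → x ⁻¹ * x ≈ 1#
  *-inverseˡ x≉0 = trans (*-comm _ _) (*-inverse x≉0)

  *-cancelˡ : ∀ {x y z} → x ≉ 0# → x * y ≈ x * z → y ≈ z
  *-cancelˡ {x} {y} {z} x≉0 xy≈xz = begin
    y                ≈⟨ expand y ⟩
    x ⁻¹ * (x * y)   ≈⟨ *-congˡ xy≈xz ⟩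
    x ⁻¹ * (x * z)   ≈⟨ sym (expand z) ⟩
    z                ∎
    where
    expand : ∀ t → t ≈ x ⁻¹ * (x * t)
    expand t = sym (trans (sym (*-assoc _ _ _))
      (trans (*-congʳ (*-inverseˡ x≉0)) (*-identityˡ t)))

  *-nonzero : ∀ {x y} → x ≉ 0# → y ≉ 0# → x * y ≉ 0#
  *-nonzero {x} {y} x≉0 y≉0 xy≈0 =
    y≉0 (*-cancelˡ x≉0 (trans xy≈0 (sym (zeroʳ x))))

  ⁻¹-nonzero : ∀ {x} → x ≉ 0# → x ⁻¹ ≉ 0#
  ⁻¹-nonzero {x} x≉0 x⁻¹≈0 =
    1≉0 (trans (sym (*-inverse x≉0)) (trans (*-congˡ x⁻¹≈0) (zeroʳ x)))

  /-cong : ∀ {x y u v} → x ≈ y → u ≈ v → x / u ≈ y / v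
  /-cong x≈y u≈v = *-cong x≈y (⁻¹-cong u≈v)

  -- x / y is the only solution z of z y = x.
  /-unique : ∀ {x y z} → y ≉ 0# → z * y ≈ x → x / y ≈ z
  /-unique {x} {y} {z} y≉0 zy≈x = begin
    x * y ⁻¹         ≈⟨ *-congʳ (sym zy≈x) ⟩
    z * y * y ⁻¹     ≈⟨ *-assoc z y _ ⟩
    z * (y * y ⁻¹)   ≈⟨ *-congˡ (*-inverse y≉0) ⟩
    z * 1#           ≈⟨ *-identityʳ z ⟩
    z                ∎

  /-expand : ∀ x {y s} → y * s ≉ 0# → x / y ≈ (x * s) / (y * s)
  /-expand x {y} {s} ys≉0 = /-unique y≉0 (*-cancelʳ (begin
    (x * s) * (y * s) ⁻¹ * y * s
      ≈⟨ solve 4 (λ x y s t → x :* s :* t :* y :* s := x :* s :* (y :* s :* t))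
               refl x y s ((y * s) ⁻¹) ⟩
    x * s * (y * s * (y * s) ⁻¹)
      ≈⟨ trans (*-congˡ (*-inverse ys≉0)) (*-identityʳ _) ⟩
    x * s ∎))
    where
    y≉0 : y ≉ 0#
    y≉0 y≈0 = ys≉0 (trans (*-congʳ y≈0) (zeroˡ s))
    s≉0 : s ≉ 0#
    s≉0 s≈0 = ys≉0 (trans (*-congˡ s≈0) (zeroʳ y))
    *-cancelʳ : ∀ {u v} → u * s ≈ v * s → u ≈ v
    *-cancelʳ us≈vs = *-cancelˡ s≉0 (trans (*-comm s _) (trans us≈vs (*-comm _ s)))

module OrderedFieldProperties {c ℓ₁ ℓ₂} (𝕆 : OrderedField c ℓ₁ ℓ₂) where
  open OrderedField 𝕆
  open IntegerCoefficients commutativeRing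
  open FieldProperties underlyingField
  open RingProperties ring
  open IsStrictTotalOrder isStrictTotalOrder public
    using (compare; irrefl; <-respˡ-≈; <-respʳ-≈) renaming (trans to <-trans)

  -- x ≤ y, as the negation of y < x.
  infix 4 _≯_
  _≯_ : Carrier → Carrier → Set ℓ₂
  x ≯ y = ¬ (y < x)

  ≯-<-trans : ∀ {x y z} → x ≯ y → y < z → x < z
  ≯-<-trans {x} {y} x≯y y<z with compare x y
  ... | tri< x<y _ _ = <-trans x<y y<z
  ... | tri≈ _ x≈y _ = <-respˡ-≈ (sym x≈y) y<z
  ... | tri> _ _ y<x = contradiction y<x x≯y

  <-≯-trans : ∀ {x y z} → x < y → y ≯ z → x < z
  <-≯-trans {x} {y} {z} x<y y≯z with compare y z
  ... | tri< y<z _ _ = <-trans x<y y<z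
  ... | tri≈ _ y≈z _ = <-respʳ-≈ y≈z x<y
  ... | tri> _ _ z<y = contradiction z<y y≯z

  +-monoʳ-< : ∀ {x y} z → x < y → z + x < z + y
  +-monoʳ-< z x<y = <-respˡ-≈ (+-comm _ _) (<-respʳ-≈ (+-comm _ _) (+-monoˡ-< z x<y))

  +-mono-< : ∀ {w x y z} → w < x → y < z → w + y < x + z
  +-mono-< w<x y<z = <-trans (+-monoˡ-< _ w<x) (+-monoʳ-< _ y<z)

  x<y⇒0<y-x : ∀ {x y} → x < y → 0# < y - x
  x<y⇒0<y-x {x} x<y = <-respˡ-≈ (-‿inverseʳ x) (+-monoˡ-< (- x) x<y)

  0<y-x⇒x<y : ∀ {x y} → 0# < y - x → x < y
  0<y-x⇒x<y {x} {y} 0<y-x =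
    <-respˡ-≈ (+-identityˡ x)
      (<-respʳ-≈ (solve 2 (λ x y → y :- x :+ x := y) refl x y) (+-monoˡ-< x 0<y-x))

  *-monoʳ-< : ∀ {x y z} → 0# < z → x < y → z * x < z * y
  *-monoʳ-< {x} {y} {z} 0<z x<y =
    0<y-x⇒x<y (<-respʳ-≈ (x[y-z]≈xy-xz z y x) (*-pos 0<z (x<y⇒0<y-x x<y)))

  *-monoˡ-< : ∀ {x y z} → 0# < z → x < y → x * z < y * z
  *-monoˡ-< 0<z x<y = <-respˡ-≈ (*-comm _ _) (<-respʳ-≈ (*-comm _ _) (*-monoʳ-< 0<z x<y))

  pos⇒≉0 : ∀ {x} → 0# < x → x ≉ 0#
  pos⇒≉0 0<x x≈0 = irrefl (sym x≈0) 0<x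

  0<1 : 0# < 1#
  0<1 with compare 0# 1#
  ... | tri< 0<1 _ _ = 0<1
  ... | tri≈ _ 0≈1 _ = contradiction (sym 0≈1) 1≉0
  ... | tri> _ _ 1<0 =
    <-respʳ-≈ (solve 0 ((𝟘 :- 𝟙) :* (𝟘 :- 𝟙) := 𝟙) refl)
      (*-pos (x<y⇒0<y-x 1<0) (x<y⇒0<y-x 1<0))

  +-pos : ∀ {x y} → 0# < x → 0# < y → 0# < x + y
  +-pos 0<x 0<y = <-respˡ-≈ (+-identityˡ 0#) (+-mono-< 0<x 0<y)

  ⁻¹-pos : ∀ {x} → 0# < x → 0# < x ⁻¹
  ⁻¹-pos {x} 0<x with compare 0# (x ⁻¹)
  ... | tri< 0<x⁻¹ _ _ = 0<x⁻¹
  ... | tri≈ _ 0≈x⁻¹ _ = contradiction (sym 0≈x⁻¹) (⁻¹-nonzero (pos⇒≉0 0<x))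
  ... | tri> _ _ x⁻¹<0 = contradiction 1<0 (λ 1<0 → irrefl refl (<-trans 0<1 1<0))
    where
    1<0 : 1# < 0#
    1<0 = <-respˡ-≈ (*-inverse (pos⇒≉0 0<x))
            (<-respʳ-≈ (zeroʳ x) (*-monoʳ-< 0<x x⁻¹<0))

  half : ∀ {x} → 0# < x → ∃[ y ] (0# < y × y + y ≈ x)
  half {x} 0<x =
    x / (1# + 1#) , *-pos 0<x (⁻¹-pos 0<2) ,
    trans (solve 2 (λ x y → x :* y :+ x :* y := x :* ((𝟙 :+ 𝟙) :* y)) refl x _)
      (trans (*-congˡ (*-inverse (pos⇒≉0 0<2))) (*-identityʳ x))
    where
    0<2 : 0# < 1# + 1#
    0<2 = +-pos 0<1 0<1

  square≈1 : ∀ {x} → 0# < x → x * x ≈ 1# → x ≈ 1#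
  square≈1 {x} 0<x xx≈1 with compare x 1#
  ... | tri≈ _ x≈1 _ = x≈1
  ... | tri< x<1 _ _ = contradiction
    (<-trans (<-respˡ-≈ xx≈1 (<-respʳ-≈ (*-identityʳ x) (*-monoʳ-< 0<x x<1))) x<1)
    (irrefl refl)
  ... | tri> _ _ 1<x = contradiction
    (<-trans 1<x (<-respʳ-≈ xx≈1 (<-respˡ-≈ (*-identityʳ x) (*-monoʳ-< 0<x 1<x))))
    (irrefl refl)

  -- If y v ≈ 1 and x < y, where x is positive, then v < 1 / x.
  inverse-antimono : ∀ {x y v} → 0# < x → x < y → y * v ≈ 1# → v < x ⁻¹
  inverse-antimono {x} {y} {v} 0<x x<y yv≈1 with compare v (x ⁻¹)
  ... | tri< v<x⁻¹ _ _ = v<x⁻¹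
  ... | tri≈ _ v≈x⁻¹ _ = contradiction
    (<-respˡ-≈ (*-inverse (pos⇒≉0 0<x))
      (<-respʳ-≈ (trans (*-congˡ (sym v≈x⁻¹)) yv≈1) (*-monoˡ-< (⁻¹-pos 0<x) x<y)))
    (irrefl refl)
  ... | tri> _ _ x⁻¹<v = contradiction
    (<-trans (<-respˡ-≈ (*-inverse (pos⇒≉0 0<x)) (*-monoˡ-< (⁻¹-pos 0<x) x<y))
      (<-respʳ-≈ yv≈1 (*-monoʳ-< (<-trans 0<x x<y) x⁻¹<v)))
    (irrefl refl)

-- Limits at infinity

module LimitProperties {c ℓ r ρ₁ ρ₂} (V : ValuedField c ℓ r ρ₁ ρ₂) where
  open ValuedField V
  open Limits V
  open FieldProperties scalars
  open IntegerCoefficients commutativeRing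
  open RingProperties ring using (-1*x≈-x; -‿involutive; -0#≈0#)
  module RP = OrderedFieldProperties values
  module RFP = FieldProperties R.underlyingField

  -- Absolute values

  0<∣x∣⇒x≉0 : ∀ {x} → R.0# R.< ∣ x ∣ → x ≉ 0#
  0<∣x∣⇒x≉0 0<∣x∣ x≈0 = RP.irrefl (R.sym (R.trans (∣∣-cong x≈0) ∣0∣)) 0<∣x∣

  ∣x∣≮0 : ∀ x → ¬ (∣ x ∣ R.< R.0#)
  ∣x∣≮0 x ∣x∣<0 = RP.irrefl R.refl (RP.<-trans ∣x∣<0 (∣∣-pos x≉0))
    where
    x≉0 : x ≉ 0#
    x≉0 x≈0 = RP.irrefl (R.trans (∣∣-cong x≈0) ∣0∣) ∣x∣<0

  ∣1∣≈1 : ∣ 1# ∣ R.≈ R.1#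
  ∣1∣≈1 = RFP.*-cancelˡ (RP.pos⇒≉0 (∣∣-pos 1≉0))
    (R.trans (R.sym (∣∣-* 1# 1#))
      (R.trans (∣∣-cong (*-identityʳ 1#)) (R.sym (R.*-identityʳ _))))

  ∣-x∣≈∣x∣ : ∀ x → ∣ - x ∣ R.≈ ∣ x ∣
  ∣-x∣≈∣x∣ x =
    R.trans (∣∣-cong (sym (-1*x≈-x x)))
      (R.trans (∣∣-* (- 1#) x) (R.trans (R.*-congʳ ∣-1∣≈1) (R.*-identityˡ _)))
    where
    [-1]²≈1 : - 1# * - 1# ≈ 1#
    [-1]²≈1 = solve 0 (:- 𝟙 :* :- 𝟙 := 𝟙) refl
    -1≉0 : - 1# ≉ 0#
    -1≉0 -1≈0 = 1≉0 (trans (sym [-1]²≈1) (trans (*-congʳ -1≈0) (zeroˡ _)))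
    ∣-1∣≈1 : ∣ - 1# ∣ R.≈ R.1#
    ∣-1∣≈1 = RP.square≈1 (∣∣-pos -1≉0)
      (R.trans (R.sym (∣∣-* _ _)) (R.trans (∣∣-cong [-1]²≈1) ∣1∣≈1))

  -- The triangle inequality |y| ≤ |x − y| + |x|.
  triangle-difference : ∀ x y → ¬ (∣ x - y ∣ R.+ ∣ x ∣ R.< ∣ y ∣)
  triangle-difference x y lt = triangle (- (x - y)) x
    (RP.<-respˡ-≈ (R.+-congʳ (R.sym (∣-x∣≈∣x∣ (x - y))))
      (RP.<-respʳ-≈ (∣∣-cong (solve 2 (λ x y → y := :- (x :- y) :+ x) refl x y)) lt))

  inverse-∣∣ : ∀ {x} → x ≉ 0# → ∣ x ∣ R.* ∣ x ⁻¹ ∣ R.≈ R.1#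
  inverse-∣∣ x≉0 = R.trans (R.sym (∣∣-* _ _)) (R.trans (∣∣-cong (*-inverse x≉0)) ∣1∣≈1)

  -- Limits

  module _ {p} {P : Carrier → Set p} where
    always : (∀ u → P u) → Eventually P
    always Pu = R.0# , λ u _ → Pu u

    eventually-map : ∀ {p′} {P′ : Carrier → Set p′} →
                     (∀ u → P u → P′ u) → Eventually P → Eventually P′
    eventually-map P⇒P′ (B , Pu) = B , λ u B<∣u∣ → P⇒P′ u (Pu u B<∣u∣)

    eventually-zip : ∀ {p′ p″} {P′ : Carrier → Set p′} {P″ : Carrier → Set p″} →
                     (∀ u → P u → P′ u → P″ u) →
                     Eventually P → Eventually P′ → Eventually P″
    eventually-zip f (B , Pu) (B′ , P′u) with RP.compare B B′
    ... | tri< B<B′ _ _ = B′ , λ u B′<∣u∣ → f u (Pu u (RP.<-trans B<B′ B′<∣u∣)) (P′u u B′<∣u∣)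
    ... | tri≈ _ B≈B′ _ = B , λ u B<∣u∣ → f u (Pu u B<∣u∣) (P′u u (RP.<-respˡ-≈ B≈B′ B<∣u∣))
    ... | tri> _ _ B′<B = B , λ u B<∣u∣ → f u (Pu u B<∣u∣) (P′u u (RP.<-trans B′<B B<∣u∣))

  eventually-≉0 : Eventually (λ u → u ≉ 0#)
  eventually-≉0 = R.0# , λ u 0<∣u∣ → 0<∣x∣⇒x≉0 0<∣u∣

  -- lim_{u → ∞} f u = 0; Limit f a is Null (λ u → f u - a).
  Null : (Carrier → Carrier) → Set _
  Null f = ∀ ε → R.0# R.< ε → Eventually (λ u → ∣ f u ∣ R.< ε)

  -- Bounded near infinity.
  Bounded : (Carrier → Carrier) → Set _
  Bounded f = ∃[ M ] (R.0# R.< M × Eventually (λ u → ∣ f u ∣ R.< M))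

  null-cong : ∀ {f g} → Eventually (λ u → f u ≈ g u) → Null f → Null g
  null-cong f≈g null ε 0<ε = eventually-zip
    (λ u fu≈gu ∣fu∣<ε → RP.<-respˡ-≈ (∣∣-cong fu≈gu) ∣fu∣<ε) f≈g (null ε 0<ε)

  null-+ : ∀ {f g} → Null f → Null g → Null (λ u → f u + g u)
  null-+ null-f null-g ε 0<ε =
    let δ , 0<δ , δ+δ≈ε = RP.half 0<ε in
    eventually-zip
      (λ u ∣fu∣<δ ∣gu∣<δ → RP.≯-<-trans (triangle _ _)
        (RP.<-respʳ-≈ δ+δ≈ε (RP.+-mono-< ∣fu∣<δ ∣gu∣<δ)))
      (null-f δ 0<δ) (null-g δ 0<δ)

  null-* : ∀ {f g} → Null f → Bounded g → Null (λ u → f u * g u)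
  null-* {f} {g} null-f (M , 0<M , ∣g∣<M) ε 0<ε = eventually-zip
    (λ u ∣fu∣<δ ∣gu∣<M → RP.<-respˡ-≈ (R.sym (∣∣-* (f u) (g u)))
      (RP.<-respʳ-≈ δM≈ε (RP.≯-<-trans
        (λ lt → RP.irrefl R.refl (RP.≯-<-trans (step u ∣gu∣<M) lt))
        (RP.*-monoˡ-< 0<M ∣fu∣<δ))))
    (null-f δ (R.*-pos 0<ε (RP.⁻¹-pos 0<M))) ∣g∣<M
    where
    δ : R.Carrier
    δ = ε R.* M R.⁻¹
    δM≈ε : δ R.* M R.≈ ε
    δM≈ε = R.trans (R.*-assoc _ _ _) (R.trans
      (R.*-congˡ (R.trans (R.*-comm _ _) (R.*-inverse (RP.pos⇒≉0 0<M)))) (R.*-identityʳ _))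
    step : ∀ u → ∣ g u ∣ R.< M → ∣ f u ∣ R.* ∣ g u ∣ RP.≯ ∣ f u ∣ R.* M
    step u ∣gu∣<M with RP.compare R.0# ∣ f u ∣
    ... | tri< 0<∣fu∣ _ _ = λ lt → RP.irrefl R.refl (RP.<-trans lt (RP.*-monoʳ-< 0<∣fu∣ ∣gu∣<M))
    ... | tri≈ _ 0≈∣fu∣ _ = RP.irrefl
      (R.trans (R.*-congʳ (R.sym 0≈∣fu∣)) (R.trans (R.zeroˡ _)
        (R.trans (R.sym (R.zeroˡ _)) (R.*-congʳ 0≈∣fu∣))))
    ... | tri> _ _ ∣fu∣<0 = contradiction ∣fu∣<0 (∣x∣≮0 (f u))

  limit⇒bounded : ∀ {f a} → Limit f a → Bounded f
  limit⇒bounded {f} {a} lim =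
    R.1# R.+ ∣ a ∣ , RP.<-≯-trans RP.0<1 1≤ , eventually-map near (lim R.1# RP.0<1)
    where
    1≤ : R.1# RP.≯ R.1# R.+ ∣ a ∣
    1≤ lt = ∣x∣≮0 a (RP.<-respˡ-≈ cancel (RP.<-respʳ-≈ (R.-‿inverseˡ R.1#) (RP.+-monoʳ-< (R.- R.1#) lt)))
      where
      cancel : R.- R.1# R.+ (R.1# R.+ ∣ a ∣) R.≈ ∣ a ∣
      cancel = R.trans (R.sym (R.+-assoc _ _ _))
        (R.trans (R.+-congʳ (R.-‿inverseˡ R.1#)) (R.+-identityˡ _))
    near : ∀ u → ∣ f u - a ∣ R.< R.1# → ∣ f u ∣ R.< R.1# R.+ ∣ a ∣
    near u lt = RP.≯-<-trans
      (λ gt → triangle (f u - a) a (RP.<-respʳ-≈ (∣∣-cong (solve 2 (λ x a → x := x :- a :+ a) refl (f u) a)) gt))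
      (R.+-monoˡ-< ∣ a ∣ lt)

  limit-cong : ∀ {f g a b} → Eventually (λ u → f u ≈ g u) → a ≈ b →
               Limit f a → Limit g b
  limit-cong f≈g a≈b = null-cong (eventually-map (λ u fu≈gu → +-cong fu≈gu (-‿cong a≈b)) f≈g)

  limit-const : ∀ a → Limit (λ _ → a) a
  limit-const a ε 0<ε = always (λ _ →
    RP.<-respˡ-≈ (R.sym (R.trans (∣∣-cong (-‿inverseʳ a)) ∣0∣)) 0<ε)

  limit-+ : ∀ {f g a b} → Limit f a → Limit g b → Limit (λ u → f u + g u) (a + b)
  limit-+ {f} {g} {a} {b} f→a g→b = null-cong
    (always (λ u → solve 4 (λ x y a b → (x :- a) :+ (y :- b) := (x :+ y) :- (a :+ b)) refl (f u) (g u) a b))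
    (null-+ f→a g→b)

  limit-* : ∀ {f g a b} → Limit f a → Limit g b → Limit (λ u → f u * g u) (a * b)
  limit-* {f} {g} {a} {b} f→a g→b = null-cong
    (always (λ u → solve 4 (λ x y a b → (x :- a) :* y :+ (y :- b) :* a := x :* y :- a :* b)
                         refl (f u) (g u) a b))
    (null-+ (null-* f→a (limit⇒bounded g→b))
            (null-* g→b (limit⇒bounded (limit-const a))))

  limit-≉0 : ∀ {f a} → a ≉ 0# → Limit f a → Eventually (λ u → f u ≉ 0#)
  -- If f u ≈ 0 then |f u − a| = |a|, so ε = |a| suffices.
  limit-≉0 {f} {a} a≉0 f→a = eventually-map
    (λ u lt fu≈0 → RP.irrefl
      (R.trans (∣∣-cong (trans (+-congʳ fu≈0) (+-identityˡ _))) (∣-x∣≈∣x∣ a)) lt)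
    (f→a ∣ a ∣ (∣∣-pos a≉0))

  limit-⁻¹ : ∀ {f a} → a ≉ 0# → Limit f a → Limit (λ u → f u ⁻¹) (a ⁻¹)
  limit-⁻¹ {f} {a} a≉0 f→a = null-cong
    (eventually-map difference f≉0)
    (null-* (null-* f→a f⁻¹-bounded) (limit⇒bounded (limit-const (- a ⁻¹))))
    where
    f≉0 : Eventually (λ u → f u ≉ 0#)
    f≉0 = limit-≉0 a≉0 f→a

    h : R.Carrier
    h = proj₁ (RP.half (∣∣-pos a≉0))
    0<h : R.0# R.< h
    0<h = proj₁ (proj₂ (RP.half (∣∣-pos a≉0)))
    h+h≈∣a∣ : h R.+ h R.≈ ∣ a ∣
    h+h≈∣a∣ = proj₂ (proj₂ (RP.half (∣∣-pos a≉0)))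

    -- Within |a| / 2 of a, the values f u stay at least |a| / 2 away from 0.
    away : ∀ u → ∣ f u - a ∣ R.< h → h R.< ∣ f u ∣
    away u lt with RP.compare h ∣ f u ∣
    ... | tri< h<∣fu∣ _ _ = h<∣fu∣
    ... | tri≈ _ h≈∣fu∣ _ = contradiction
      (RP.<-respʳ-≈ h+h≈∣a∣ (RP.<-respʳ-≈ (R.+-congˡ (R.sym h≈∣fu∣)) (R.+-monoˡ-< ∣ f u ∣ lt)))
      (triangle-difference (f u) a)
    ... | tri> _ _ ∣fu∣<h = contradiction
      (RP.<-respʳ-≈ h+h≈∣a∣ (RP.+-mono-< lt ∣fu∣<h)) (triangle-difference (f u) a)

    f⁻¹-bounded : Bounded (λ u → f u ⁻¹)
    f⁻¹-bounded = h R.⁻¹ , RP.⁻¹-pos 0<h , eventually-zip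
      (λ u fu≉0 lt → RP.inverse-antimono 0<h (away u lt) (inverse-∣∣ fu≉0))
      f≉0 (f→a h 0<h)

    difference : ∀ u → f u ≉ 0# → ((f u - a) * f u ⁻¹) * (- a ⁻¹) ≈ f u ⁻¹ - a ⁻¹
    difference u fu≉0 = trans
      (solve 4 (λ x x⁻¹ a a⁻¹ → (x :- a) :* x⁻¹ :* :- a⁻¹ := (a :* a⁻¹) :* x⁻¹ :- (x :* x⁻¹) :* a⁻¹)
             refl (f u) (f u ⁻¹) a (a ⁻¹))
      (+-cong (trans (*-congʳ (*-inverse a≉0)) (*-identityˡ _))
        (-‿cong (trans (*-congʳ (*-inverse fu≉0)) (*-identityˡ _))))

  limit-/ : ∀ {f g a b} → b ≉ 0# → Limit f a → Limit g b → Limit (λ u → f u / g u) (a / b)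
  limit-/ b≉0 f→a g→b = limit-* f→a (limit-⁻¹ b≉0 g→b)

  limit-u⁻¹ : Limit (λ u → u ⁻¹) 0#
  -- |u| > 1 / ε gives |1 / u| < ε.
  limit-u⁻¹ ε 0<ε = ε R.⁻¹ , λ u lt →
    let u≉0 = 0<∣x∣⇒x≉0 (RP.<-trans (RP.⁻¹-pos 0<ε) lt) in
    RP.<-respˡ-≈ (∣∣-cong (sym (trans (+-congˡ -0#≈0#) (+-identityʳ _))))
      (RP.<-respʳ-≈ (ε⁻¹⁻¹≈ε 0<ε) (RP.inverse-antimono (RP.⁻¹-pos 0<ε) lt (inverse-∣∣ u≉0)))
    where
    ε⁻¹⁻¹≈ε : ∀ {ε} → R.0# R.< ε → (ε R.⁻¹) R.⁻¹ R.≈ ε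
    ε⁻¹⁻¹≈ε {ε} 0<ε = RFP.*-cancelˡ ε⁻¹≉0
      (R.trans (R.*-inverse ε⁻¹≉0) (R.sym (RFP.*-inverseˡ (RP.pos⇒≉0 0<ε))))
      where
      ε⁻¹≉0 : ε R.⁻¹ R.≉ R.0#
      ε⁻¹≉0 = RP.pos⇒≉0 (RP.⁻¹-pos 0<ε)

  -- Iterated limits

  iterated-cong : ∀ {n f g a b} → (∀ u → f u ≈ g u) → a ≈ b →
                  IteratedLimit n f a → IteratedLimit n g b
  iterated-cong {zero} f≈g a≈b (lift f≈a) =
    lift (trans (sym (f≈g [])) (trans f≈a a≈b))
  iterated-cong {suc n} f≈g a≈b (g , ev , lim) =
    g , eventually-map (λ u → iterated-cong (λ us → f≈g (u ∷ us)) refl) ev ,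
    limit-cong (always (λ _ → refl)) a≈b lim

  iterated-const : ∀ n a → IteratedLimit n (λ _ → a) a
  iterated-const zero    a = lift refl
  iterated-const (suc n) a = (λ _ → a) , always (λ _ → iterated-const n a) , limit-const a

  iterated-+ : ∀ {n f g a b} → IteratedLimit n f a → IteratedLimit n g b →
               IteratedLimit n (λ u → f u + g u) (a + b)
  iterated-+ {zero}  (lift f≈a) (lift g≈b) = lift (+-cong f≈a g≈b)
  iterated-+ {suc n} (f′ , f→f′ , f′→a) (g′ , g→g′ , g′→b) =
    (λ u → f′ u + g′ u) , eventually-zip (λ u → iterated-+) f→f′ g→g′ , limit-+ f′→a g′→b

  iterated-* : ∀ {n f g a b} → IteratedLimit n f a → IteratedLimit n g b →
               IteratedLimit n (λ u → f u * g u) (a * b)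
  iterated-* {zero}  (lift f≈a) (lift g≈b) = lift (*-cong f≈a g≈b)
  iterated-* {suc n} (f′ , f→f′ , f′→a) (g′ , g→g′ , g′→b) =
    (λ u → f′ u * g′ u) , eventually-zip (λ u → iterated-*) f→f′ g→g′ , limit-* f′→a g′→b

  -- A nonzero iterated limit b makes the inner limits g′ u nonzero for large u,
  -- so the inner quotients have limits too.
  iterated-/ : ∀ {n f g a b} → b ≉ 0# → IteratedLimit n f a → IteratedLimit n g b →
               IteratedLimit n (λ u → f u / g u) (a / b)
  iterated-/ {zero}  b≉0 (lift f≈a) (lift g≈b) = lift (/-cong f≈a g≈b)
  iterated-/ {suc n} b≉0 (f′ , f→f′ , f′→a) (g′ , g→g′ , g′→b) =
    (λ u → f′ u / g′ u) ,
    eventually-zip (λ u g′u≉0 (fu , gu) → iterated-/ g′u≉0 fu gu)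
      (limit-≉0 b≉0 g′→b) (eventually-zip (λ _ → _,_) f→f′ g→g′) ,
    limit-/ b≉0 f′→a g′→b

-- Vectors of labels

module Labels where
  open ≡.≡-Reasoning
  open CommutativeSemigroupProperties ℕ.+-commutativeSemigroup
    using (x∙yz≈y∙xz; xy∙z≈y∙xz; interchange)

  -- By how much the total of the labels falls short of 2 per label.
  deficiency : ∀ {n} → Vec State n → ℕ
  deficiency I = Vec.sum (Vec.map (λ j → 2 ∸ toℕ j) I)

  opposite-2∸ : ∀ (i : State) → 2 ∸ toℕ i ≡ toℕ (opposite i)
  opposite-2∸ 0F = ≡.refl
  opposite-2∸ 1F = ≡.refl
  opposite-2∸ 2F = ≡.refl

  toℕ+opposite : ∀ (i : State) → toℕ i ℕ.+ toℕ (opposite i) ≡ 2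
  toℕ+opposite 0F = ≡.refl
  toℕ+opposite 1F = ≡.refl
  toℕ+opposite 2F = ≡.refl

  ∣∣+deficiency : ∀ {n} (I : Vec State n) → ∣ I ∣ᵥ ℕ.+ deficiency I ≡ n ℕ.+ n
  ∣∣+deficiency [] = ≡.refl
  ∣∣+deficiency {suc n} (i ∷ I) rewrite opposite-2∸ i = begin
    (toℕ i ℕ.+ ∣ I ∣ᵥ) ℕ.+ (toℕ (opposite i) ℕ.+ deficiency I)
      ≡⟨ interchange (toℕ i) ∣ I ∣ᵥ _ _ ⟩
    (toℕ i ℕ.+ toℕ (opposite i)) ℕ.+ (∣ I ∣ᵥ ℕ.+ deficiency I)
      ≡⟨ ≡.cong₂ ℕ._+_ (toℕ+opposite i) (∣∣+deficiency I) ⟩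
    2 ℕ.+ (n ℕ.+ n)
      ≡⟨ ≡.cong suc (≡.sym (ℕ.+-suc n n)) ⟩
    suc n ℕ.+ suc n ∎

  sum-map-* : ∀ k {n} (I : Vec State n) →
    Vec.sum (Vec.map (λ j → k ℕ.* (2 ∸ toℕ j)) I) ≡ k ℕ.* deficiency I
  sum-map-* k []      = ≡.sym (ℕ.*-zeroʳ k)
  sum-map-* k (i ∷ I) = ≡.trans (≡.cong (k ℕ.* (2 ∸ toℕ i) ℕ.+_) (sum-map-* k I))
    (≡.sym (ℕ.*-distribˡ-+ k (2 ∸ toℕ i) (deficiency I)))

  -- Conservation at the first vertex of a column and in the rest of the column
  -- gives conservation in the whole column.
  balance-∷ : ∀ a i b j t m n → a ℕ.+ i ≡ b ℕ.+ j → b ℕ.+ m ≡ t ℕ.+ n →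
              a ℕ.+ (i ℕ.+ m) ≡ t ℕ.+ (j ℕ.+ n)
  balance-∷ a i b j t m n eq eq′ = begin
    a ℕ.+ (i ℕ.+ m)   ≡⟨ ≡.sym (ℕ.+-assoc a i m) ⟩
    (a ℕ.+ i) ℕ.+ m   ≡⟨ ≡.cong (ℕ._+ m) eq ⟩
    (b ℕ.+ j) ℕ.+ m   ≡⟨ xy∙z≈y∙xz b j m ⟩
    j ℕ.+ (b ℕ.+ m)   ≡⟨ ≡.cong (j ℕ.+_) eq′ ⟩
    j ℕ.+ (t ℕ.+ n)   ≡⟨ x∙yz≈y∙xz j t n ⟩
    t ℕ.+ (j ℕ.+ n)   ∎

  deficiency-value : ∀ {n} (I : Vec State n) {m K} → m ℕ.+ K ≡ n →
                     ∣ I ∣ᵥ ≡ 2 ℕ.* K → deficiency I ≡ m ℕ.+ m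
  deficiency-value {n} I {m} {K} ≡.refl eq = ℕ.+-cancelˡ-≡ (K ℕ.+ K) _ _ (begin
    (K ℕ.+ K) ℕ.+ deficiency I  ≡⟨ ≡.cong (λ k → K ℕ.+ k ℕ.+ deficiency I) (≡.sym (ℕ.+-identityʳ K)) ⟩
    2 ℕ.* K ℕ.+ deficiency I    ≡⟨ ≡.cong (ℕ._+ deficiency I) (≡.sym eq) ⟩
    ∣ I ∣ᵥ ℕ.+ deficiency I     ≡⟨ ∣∣+deficiency I ⟩
    (m ℕ.+ K) ℕ.+ (m ℕ.+ K)     ≡⟨ interchange m K m K ⟩
    (m ℕ.+ m) ℕ.+ (K ℕ.+ K)     ≡⟨ ℕ.+-comm (m ℕ.+ m) _ ⟩
    (K ℕ.+ K) ℕ.+ (m ℕ.+ m)     ∎)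

  -- If the labels of a column balance, so do the deficiencies of its sides.
  deficiency-balance : ∀ {n} (a t : State) (I J : Vec State n) →
    toℕ a ℕ.+ ∣ I ∣ᵥ ≡ toℕ t ℕ.+ ∣ J ∣ᵥ →
    toℕ a ℕ.+ deficiency J ≡ toℕ t ℕ.+ deficiency I
  deficiency-balance {n} a t I J eq = ℕ.+-cancelʳ-≡ (∣ I ∣ᵥ ℕ.+ ∣ J ∣ᵥ) _ _ (begin
    (toℕ a ℕ.+ deficiency J) ℕ.+ (∣ I ∣ᵥ ℕ.+ ∣ J ∣ᵥ)
      ≡⟨ interchange (toℕ a) (deficiency J) ∣ I ∣ᵥ ∣ J ∣ᵥ ⟩
    (toℕ a ℕ.+ ∣ I ∣ᵥ) ℕ.+ (deficiency J ℕ.+ ∣ J ∣ᵥ)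
      ≡⟨ ≡.cong₂ ℕ._+_ eq (≡.trans (ℕ.+-comm (deficiency J) _) (∣∣+deficiency J)) ⟩
    (toℕ t ℕ.+ ∣ J ∣ᵥ) ℕ.+ (n ℕ.+ n)
      ≡⟨ ≡.cong (toℕ t ℕ.+ ∣ J ∣ᵥ ℕ.+_) (≡.sym (≡.trans (ℕ.+-comm (deficiency I) _) (∣∣+deficiency I))) ⟩
    (toℕ t ℕ.+ ∣ J ∣ᵥ) ℕ.+ (deficiency I ℕ.+ ∣ I ∣ᵥ)
      ≡⟨ interchange (toℕ t) ∣ J ∣ᵥ (deficiency I) ∣ I ∣ᵥ ⟩
    (toℕ t ℕ.+ deficiency I) ℕ.+ (∣ J ∣ᵥ ℕ.+ ∣ I ∣ᵥ)
      ≡⟨ ≡.cong (toℕ t ℕ.+ deficiency I ℕ.+_) (ℕ.+-comm ∣ J ∣ᵥ _) ⟩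
    (toℕ t ℕ.+ deficiency I) ℕ.+ (∣ I ∣ᵥ ℕ.+ ∣ J ∣ᵥ) ∎)

  deficiency≡0 : ∀ {n} (I : Vec State n) → deficiency I ≡ 0 → I ≡ twos n
  deficiency≡0 []       _  = ≡.refl
  deficiency≡0 (2F ∷ I) eq = ≡.cong (2F ∷_) (deficiency≡0 I eq)

  deficiency-twos : ∀ n → deficiency (twos n) ≡ 0
  deficiency-twos zero    = ≡.refl
  deficiency-twos (suc n) = deficiency-twos n

  ∣∣≡2n⇒twos : ∀ {n} (I : Vec State n) → ∣ I ∣ᵥ ≡ 2 ℕ.* n → I ≡ twos n
  ∣∣≡2n⇒twos {n} I eq = deficiency≡0 I (ℕ.+-cancelˡ-≡ ∣ I ∣ᵥ _ _
    (≡.trans (∣∣+deficiency I) (≡.trans (≡.cong (n ℕ.+_) (≡.sym (ℕ.+-identityʳ n)))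
      (≡.trans (≡.sym eq) (≡.sym (ℕ.+-identityʳ _))))))

  ∣twos∣ : ∀ n → ∣ twos n ∣ᵥ ≡ 2 ℕ.* n
  ∣twos∣ n = ≡.trans (≡.sym (ℕ.+-identityʳ _))
    (≡.trans (≡.cong (∣ twos n ∣ᵥ ℕ.+_) (≡.sym (deficiency-twos n)))
      (≡.trans (∣∣+deficiency (twos n)) (≡.cong (n ℕ.+_) (≡.sym (ℕ.+-identityʳ n)))))

  zeros : ∀ n → Vec State n
  zeros n = Vec.replicate n 0F

  ∣∣≡0⇒zeros : ∀ {n} (I : Vec State n) → ∣ I ∣ᵥ ≡ 0 → I ≡ zeros n
  ∣∣≡0⇒zeros []       _  = ≡.refl
  ∣∣≡0⇒zeros (0F ∷ I) eq = ≡.cong (0F ∷_) (∣∣≡0⇒zeros I eq)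

  ∣zeros∣ : ∀ n → ∣ zeros n ∣ᵥ ≡ 0
  ∣zeros∣ zero    = ≡.refl
  ∣zeros∣ (suc n) = ∣zeros∣ n

open Labels

-- Partition functions and transfer matrices

module PartitionFunctions {c ℓ} (𝔽 : Field c ℓ) (q : Field.Carrier 𝔽) where
  open Field 𝔽
  open IzerginKorepin 𝔽 q
  open IntegerCoefficients commutativeRing
  open SetoidReasoning setoid
  open Sum *-commutativeMonoid
    using () renaming (sum to ∏; sum-cong-≋ to ∏-cong; ∑-distrib-+ to ∏-distrib-*)

  module _ {a} {A : Set a} where
    ∑-cong : ∀ (as : List A) {f g} → (∀ a → f a ≈ g a) → ∑ as f ≈ ∑ as g
    ∑-cong List.[]       f≈g = refl
    ∑-cong (a List.∷ as) f≈g = +-cong (f≈g a) (∑-cong as f≈g)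

    ∑-zero : ∀ (as : List A) {f} → (∀ a → f a ≈ 0#) → ∑ as f ≈ 0#
    ∑-zero List.[]       f≈0 = refl
    ∑-zero (a List.∷ as) f≈0 = trans (+-cong (f≈0 a) (∑-zero as f≈0)) (+-identityˡ 0#)

    ∑-+ : ∀ (as : List A) f g → ∑ as (λ a → f a + g a) ≈ ∑ as f + ∑ as g
    ∑-+ List.[]       f g = sym (+-identityˡ 0#)
    ∑-+ (a List.∷ as) f g = trans (+-congˡ (∑-+ as f g))
      (solve 4 (λ x y s t → x :+ y :+ (s :+ t) := x :+ s :+ (y :+ t)) refl _ _ _ _)

    ∑-*ˡ : ∀ (as : List A) k f → ∑ as (λ a → k * f a) ≈ k * ∑ as f
    ∑-*ˡ List.[]       k f = sym (zeroʳ k)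
    ∑-*ˡ (a List.∷ as) k f = trans (+-congˡ (∑-*ˡ as k f)) (sym (distribˡ k _ _))

    ∑-*ʳ : ∀ (as : List A) f k → ∑ as (λ a → f a * k) ≈ ∑ as f * k
    ∑-*ʳ as f k = trans (∑-cong as (λ a → *-comm (f a) k)) (trans (∑-*ˡ as k f) (*-comm k _))

    ∑-++ : ∀ (as bs : List A) f → ∑ (as List.++ bs) f ≈ ∑ as f + ∑ bs f
    ∑-++ List.[]       bs f = sym (+-identityˡ _)
    ∑-++ (a List.∷ as) bs f = trans (+-congˡ (∑-++ as bs f)) (sym (+-assoc _ _ _))

  ∑-map : ∀ {a b} {A : Set a} {B : Set b} (g : A → B) as f →
          ∑ (List.map g as) f ≡ ∑ as (f ∘ g)
  ∑-map g List.[]       f = ≡.refl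
  ∑-map g (a List.∷ as) f = ≡.cong (f (g a) +_) (∑-map g as f)

  module _ {a b} {A : Set a} {B : Set b} where
    ∑-swap : ∀ (as : List A) (bs : List B) (f : A → B → Carrier) →
             ∑ as (λ a → ∑ bs (f a)) ≈ ∑ bs (λ b → ∑ as (λ a → f a b))
    ∑-swap List.[]       bs f = sym (∑-zero bs (λ _ → refl))
    ∑-swap (a List.∷ as) bs f = trans (+-congˡ (∑-swap as bs f)) (sym (∑-+ bs (f a) _))

    ∑-*-∑ : ∀ (as : List A) (bs : List B) f g →
            ∑ as (λ a → ∑ bs (λ b → f a * g b)) ≈ ∑ as f * ∑ bs g
    ∑-*-∑ as bs f g = trans (∑-cong as (λ a → ∑-*ˡ bs (f a) g)) (∑-*ʳ as f _)

    ∑-cartesianProductWith :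
      ∀ {d} {D : Set d} (g : A → B → D) as bs f →
      ∑ (List.cartesianProductWith g as bs) f ≈ ∑ as (λ a → ∑ bs (λ b → f (g a b)))
    ∑-cartesianProductWith g List.[]       bs f = refl
    ∑-cartesianProductWith g (a List.∷ as) bs f = trans
      (∑-++ (List.map (g a) bs) _ f)
      (+-cong (reflexive (∑-map (g a) bs f)) (∑-cartesianProductWith g as bs f))

  -- The indicator function of a decidable proposition.
  𝟏 : ∀ {p} {P : Set p} → Dec P → Carrier
  𝟏 P? = if does P? then 1# else 0#

  module _ {p p′} {P : Set p} {P′ : Set p′} where
    𝟏-⇔ : (P → P′) → (P′ → P) → (P? : Dec P) (P′? : Dec P′) → 𝟏 P? ≈ 𝟏 P′?
    𝟏-⇔ f g (yes _)  (yes _)   = refl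
    𝟏-⇔ f g (yes p)  (no ¬p′)  = contradiction (f p) ¬p′
    𝟏-⇔ f g (no ¬p)  (yes p′)  = contradiction (g p′) ¬p
    𝟏-⇔ f g (no _)   (no _)    = refl

    𝟏-× : (P? : Dec P) (P′? : Dec P′) → 𝟏 (P? ×-dec P′?) ≈ 𝟏 P? * 𝟏 P′?
    𝟏-× (yes _) P′? = sym (*-identityˡ _)
    𝟏-× (no _)  P′? = sym (zeroˡ _)

  -- A factor may be replaced by what it equals where the indicator is nonzero.
  𝟏-*-cong : ∀ {p} {P : Set p} (P? : Dec P) {x y} → (P → x ≈ y) → 𝟏 P? * x ≈ 𝟏 P? * y
  𝟏-*-cong (yes p) x≈y = *-congˡ (x≈y p)
  𝟏-*-cong (no _)  x≈y = trans (zeroˡ _) (sym (zeroˡ _))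

  ∑-filter : ∀ {a p} {A : Set a} {P : A → Set p} (P? : ∀ a → Dec (P a)) as f →
             ∑ (List.filter P? as) f ≈ ∑ as (λ a → 𝟏 (P? a) * f a)
  ∑-filter P? List.[]       f = refl
  ∑-filter P? (a List.∷ as) f with does (P? a)
  ... | true  = +-cong (sym (*-identityˡ _)) (∑-filter P? as f)
  ... | false = trans (∑-filter P? as f)
    (sym (trans (+-congʳ (zeroˡ _)) (+-identityˡ _)))

  states : List State
  states = List.allFin 3

  ∑-vectors : ∀ {a} {A : Set a} (as : List A) n (f : Vec A (suc n) → Carrier) →
              ∑ (vectors as (suc n)) f ≈ ∑ as (λ a → ∑ (vectors as n) (λ v → f (a ∷ v)))
  ∑-vectors as n f = ∑-cartesianProductWith _∷_ as (vectors as n) f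

  𝟏-∷ : ∀ {n} i j (I J : Vec State n) →
        𝟏 (i ∷ I ≟ᵥ j ∷ J) ≈ 𝟏 (i Fin.≟ j) * 𝟏 (I ≟ᵥ J)
  𝟏-∷ i j I J = trans
    (𝟏-⇔ Vec.∷-injective (λ (p , p′) → ≡.cong₂ _∷_ p p′)
         (i ∷ I ≟ᵥ j ∷ J) (i Fin.≟ j ×-dec I ≟ᵥ J))
    (𝟏-× (i Fin.≟ j) (I ≟ᵥ J))

  ∑-𝟏-state : ∀ i (f : State → Carrier) → ∑ states (λ j → 𝟏 (j Fin.≟ i) * f j) ≈ f i
  ∑-𝟏-state 0F f = solve 3 (λ x y z → 𝟙 :* x :+ (𝟘 :* y :+ (𝟘 :* z :+ 𝟘)) := x) refl _ _ _
  ∑-𝟏-state 1F f = solve 3 (λ x y z → 𝟘 :* x :+ (𝟙 :* y :+ (𝟘 :* z :+ 𝟘)) := y) refl _ _ _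
  ∑-𝟏-state 2F f = solve 3 (λ x y z → 𝟘 :* x :+ (𝟘 :* y :+ (𝟙 :* z :+ 𝟘)) := z) refl _ _ _

  ∑-𝟏 : ∀ {n} (I : Vec State n) (f : Vec State n → Carrier) → ∑ (words n) (λ J → 𝟏 (J ≟ᵥ I) * f J) ≈ f I
  ∑-𝟏 []            f = trans (+-identityʳ _) (*-identityˡ _)
  ∑-𝟏 {suc n} (i ∷ I) f = begin
    ∑ (words (suc n)) (λ J → 𝟏 (J ≟ᵥ i ∷ I) * f J)
      ≈⟨ ∑-vectors states n _ ⟩
    ∑ states (λ j → ∑ (words n) (λ J → 𝟏 (j ∷ J ≟ᵥ i ∷ I) * f (j ∷ J)))
      ≈⟨ ∑-cong states (λ j → ∑-cong (words n) (λ J →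
           trans (*-congʳ (𝟏-∷ j i J I)) (*-assoc (𝟏 (j Fin.≟ i)) (𝟏 (J ≟ᵥ I)) (f (j ∷ J))))) ⟩
    ∑ states (λ j → ∑ (words n) (λ J → 𝟏 (j Fin.≟ i) * (𝟏 (J ≟ᵥ I) * f (j ∷ J))))
      ≈⟨ ∑-cong states (λ j → trans
           (∑-*ˡ (words n) (𝟏 (j Fin.≟ i)) (λ J → 𝟏 (J ≟ᵥ I) * f (j ∷ J)))
           (*-congˡ (∑-𝟏 I (f ∘ (j ∷_))))) ⟩
    ∑ states (λ j → 𝟏 (j Fin.≟ i) * f (j ∷ I))
      ≈⟨ ∑-𝟏-state i (λ j → f (j ∷ I)) ⟩
    f (i ∷ I) ∎

  ∑-𝟏′ : ∀ {n} (I : Vec State n) (f : Vec State n → Carrier) → ∑ (words n) (λ J → 𝟏 (I ≟ᵥ J) * f J) ≈ f I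
  ∑-𝟏′ I f = trans
    (∑-cong (words _) (λ J → *-congʳ (𝟏-⇔ ≡.sym ≡.sym (I ≟ᵥ J) (J ≟ᵥ I))))
    (∑-𝟏 I f)

  -- The weight of a vertex as a function of its bottom, left, top and right
  -- labels.
  Weight : Set c
  Weight = (i j k l : State) → Carrier

  -- The weight of a row of L vertices, with bottom labels v, horizontal labels
  -- h and top labels v′; column c has weights ω c, which may depend on the
  -- parameter x of the row.
  rowWeight : ∀ {L} → (ℕ → Carrier → Weight) → Carrier →
              Vec State L → Vec State (suc L) → Vec State L → Carrier
  rowWeight ω x v h v′ = ∏ λ c →
    ω (toℕ c) x (lookup v c) (lookup h (inject₁ c)) (lookup v′ c) (lookup h (fsuc c))

  -- The weight of a configuration, for column weights ω and row parameters x.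
  latticeWeight : ∀ {N L} → (ℕ → Carrier → Weight) → Vec Carrier N →
                  Configuration N L → Carrier
  latticeWeight ω x (h , v) = ∏ λ r →
    rowWeight ω (lookup x r) (lookup v (inject₁ r)) (lookup h r) (lookup v (fsuc r))

  -- The partition function with left boundary I, top boundary s, and empty
  -- bottom and right boundaries.
  partition : ∀ {N L} → Vec State L → (ℕ → Carrier → Weight) → Vec Carrier N →
              Vec State N → Carrier
  partition {N} {L} s ω x I =
    ∑ (List.filter (hasBoundary? I s) (configurations N L)) (latticeWeight ω x)

  -- The weight of one column with bottom label a and top label t, left labels I
  -- and right labels J, summed over its inner vertical labels.
  column : ∀ {N} → (Carrier → Weight) → State → State →
           Vec Carrier N → Vec State N → Vec State N → Carrier
  column w a t []       []      []      = 𝟏 (a Fin.≟ t)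
  column w a t (x ∷ xs) (i ∷ I) (j ∷ J) =
    ∑ states (λ b → w x a i b j * column w b t xs I J)

  -- The weight of one column with vertical labels b, from bottom to top, left
  -- labels I and right labels J.
  columnWeight : ∀ {N} → (Carrier → Weight) → Vec Carrier N →
                 Vec State (suc N) → Vec State N → Vec State N → Carrier
  columnWeight w x b I J = ∏ λ r →
    w (lookup x r) (lookup b (inject₁ r)) (lookup I r) (lookup b (fsuc r)) (lookup J r)

  ∑-columnWeight-∷ : ∀ {N} w a t x (I J : Vec State N) →
    ∑ (words N) (λ b → 𝟏 (Vec.last (a ∷ b) Fin.≟ t) * columnWeight w x (a ∷ b) I J)
      ≈ column w a t x I J
  ∑-columnWeight-∷ w a t [] [] [] = trans (+-identityʳ _) (*-identityʳ _)
  ∑-columnWeight-∷ {suc N} w a t (x ∷ xs) (i ∷ I) (j ∷ J) = trans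
    (∑-vectors states N _)
    (∑-cong states (λ b → begin
      ∑ (words N) (λ bs → 𝟏 (Vec.last (b ∷ bs) Fin.≟ t)
                            * (w x a i b j * columnWeight w xs (b ∷ bs) I J))
        ≈⟨ ∑-cong (words N) (λ bs →
             solve 3 (λ x y z → x :* (y :* z) := y :* (x :* z)) refl
               (𝟏 (Vec.last (b ∷ bs) Fin.≟ t)) (w x a i b j) (columnWeight w xs (b ∷ bs) I J)) ⟩
      ∑ (words N) (λ bs → w x a i b j * (𝟏 (Vec.last (b ∷ bs) Fin.≟ t)
                                          * columnWeight w xs (b ∷ bs) I J))
        ≈⟨ ∑-*ˡ (words N) _ _ ⟩
      w x a i b j * ∑ (words N) (λ bs → 𝟏 (Vec.last (b ∷ bs) Fin.≟ t)
                                          * columnWeight w xs (b ∷ bs) I J)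
        ≈⟨ *-congˡ (∑-columnWeight-∷ w b t xs I J) ⟩
      w x a i b j * column w b t xs I J ∎))

  ∑-columnWeight : ∀ {N} w a t x (I J : Vec State N) →
    ∑ (words (suc N)) (λ b → (𝟏 (Vec.head b Fin.≟ a) * 𝟏 (Vec.last b Fin.≟ t))
                               * columnWeight w x b I J)
      ≈ column w a t x I J
  ∑-columnWeight {N} w a t x I J = begin
    ∑ (words (suc N)) (λ b → (𝟏 (Vec.head b Fin.≟ a) * 𝟏 (Vec.last b Fin.≟ t))
                               * columnWeight w x b I J)
      ≈⟨ ∑-vectors states N _ ⟩
    ∑ states (λ b → ∑ (words N) (λ bs →
      (𝟏 (b Fin.≟ a) * 𝟏 (Vec.last (b ∷ bs) Fin.≟ t)) * columnWeight w x (b ∷ bs) I J))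
      ≈⟨ ∑-cong states (λ b → trans
           (∑-cong (words N) (λ bs → *-assoc (𝟏 (b Fin.≟ a)) (𝟏 (Vec.last (b ∷ bs) Fin.≟ t)) _))
           (∑-*ˡ (words N) (𝟏 (b Fin.≟ a)) (λ bs →
              𝟏 (Vec.last (b ∷ bs) Fin.≟ t) * columnWeight w x (b ∷ bs) I J))) ⟩
    ∑ states (λ b → 𝟏 (b Fin.≟ a) * ∑ (words N) (λ bs →
      𝟏 (Vec.last (b ∷ bs) Fin.≟ t) * columnWeight w x (b ∷ bs) I J))
      ≈⟨ ∑-𝟏-state a (λ b → ∑ (words N) (λ bs →
           𝟏 (Vec.last (b ∷ bs) Fin.≟ t) * columnWeight w x (b ∷ bs) I J)) ⟩
    ∑ (words N) (λ bs → 𝟏 (Vec.last (a ∷ bs) Fin.≟ t) * columnWeight w x (a ∷ bs) I J)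
      ≈⟨ ∑-columnWeight-∷ w a t x I J ⟩
    column w a t x I J ∎

  -- Transposition: a matrix is a first column and the remaining columns.
  ∑-first-column : ∀ n L (f : Vec (Vec State (suc L)) n → Carrier) →
    ∑ (vectors (words (suc L)) n) f
      ≈ ∑ (words n) (λ a → ∑ (vectors (words L) n) (λ m → f (zipWith _∷_ a m)))
  ∑-first-column zero    L f = +-congʳ (sym (+-identityʳ _))
  ∑-first-column (suc n) L f = begin
    ∑ (vectors (words (suc L)) (suc n)) f
      ≈⟨ ∑-vectors (words (suc L)) n f ⟩
    ∑ (words (suc L)) (λ r → ∑ (vectors (words (suc L)) n) (λ m → f (r ∷ m)))
      ≈⟨ ∑-vectors states L _ ⟩
    ∑ states (λ i → ∑ (words L) (λ r → ∑ (vectors (words (suc L)) n) (λ m → f ((i ∷ r) ∷ m))))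
      ≈⟨ ∑-cong states (λ i → trans
           (∑-cong (words L) (λ r → ∑-first-column n L (λ m → f ((i ∷ r) ∷ m))))
           (∑-swap (words L) (words n) (λ r a → ∑ (vectors (words L) n)
             (λ m → f ((i ∷ r) ∷ zipWith _∷_ a m))))) ⟩
    ∑ states (λ i → ∑ (words n) (λ a → ∑ (words L) (λ r → ∑ (vectors (words L) n)
      (λ m → f ((i ∷ r) ∷ zipWith _∷_ a m)))))
      ≈⟨ ∑-cong states (λ i → ∑-cong (words n) (λ a → sym (∑-vectors (words L) n
           (λ m → f (zipWith _∷_ (i ∷ a) m))))) ⟩
    ∑ states (λ i → ∑ (words n) (λ a → ∑ (vectors (words L) (suc n))
      (λ m → f (zipWith _∷_ (i ∷ a) m))))
      ≈⟨ sym (∑-vectors states n _) ⟩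
    ∑ (words (suc n)) (λ a → ∑ (vectors (words L) (suc n)) (λ m → f (zipWith _∷_ a m))) ∎

  map-head-zipWith-∷ : ∀ {N L} (a : Vec State N) (m : Vec (Vec State L) N) →
                       Vec.map Vec.head (zipWith _∷_ a m) ≡ a
  map-head-zipWith-∷ []      []      = ≡.refl
  map-head-zipWith-∷ (i ∷ a) (r ∷ m) = ≡.cong (i ∷_) (map-head-zipWith-∷ a m)

  map-last-zipWith-∷ : ∀ {N L} (a : Vec State N) (m : Vec (Vec State (suc L)) N) →
                       Vec.map Vec.last (zipWith _∷_ a m) ≡ Vec.map Vec.last m
  map-last-zipWith-∷ []      []            = ≡.refl
  map-last-zipWith-∷ (i ∷ a) ((j ∷ r) ∷ m) = ≡.cong (_ ∷_) (map-last-zipWith-∷ a m)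

  last-zipWith-∷ : ∀ {N L} (a : Vec State (suc N)) (m : Vec (Vec State L) (suc N)) →
                   Vec.last (zipWith _∷_ a m) ≡ Vec.last a ∷ Vec.last m
  last-zipWith-∷ (i ∷ [])    (r ∷ [])    = ≡.refl
  last-zipWith-∷ (i ∷ j ∷ a) (r ∷ t ∷ m) = last-zipWith-∷ (j ∷ a) (t ∷ m)

  -- The indicator of the right, bottom and top boundary conditions.
  boundary : ∀ {N L} → Vec State L → Configuration N L → Carrier
  boundary {N} {L} s (h , v) =
    𝟏 (Vec.map Vec.last h ≟ᵥ Vec.replicate N 0F) *
    (𝟏 (Vec.head v ≟ᵥ Vec.replicate L 0F) * 𝟏 (Vec.last v ≟ᵥ s))

  partition-𝟏 : ∀ {N L} (s : Vec State L) ω x (I : Vec State N) →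
    partition s ω x I ≈
      ∑ (vectors (words (suc L)) N) (λ h → 𝟏 (Vec.map Vec.head h ≟ᵥ I) *
        ∑ (vectors (words L) (suc N)) (λ v → boundary s (h , v) * latticeWeight ω x (h , v)))
  partition-𝟏 {N} {L} s ω x I = begin
    partition s ω x I
      ≈⟨ ∑-filter (hasBoundary? I s) (configurations N L) _ ⟩
    ∑ (configurations N L) (λ C → 𝟏 (hasBoundary? I s C) * latticeWeight ω x C)
      ≈⟨ ∑-cartesianProductWith _,_ (vectors (words (suc L)) N) _ _ ⟩
    ∑ (vectors (words (suc L)) N) (λ h → ∑ (vectors (words L) (suc N)) (λ v →
      𝟏 (hasBoundary? I s (h , v)) * latticeWeight ω x (h , v)))
      ≈⟨ ∑-cong (vectors (words (suc L)) N) (λ h → trans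
           (∑-cong (vectors (words L) (suc N)) (λ v →
             trans (*-congʳ (split h v)) (*-assoc _ _ _)))
           (∑-*ˡ (vectors (words L) (suc N)) _ _)) ⟩
    _ ∎
    where
    split : ∀ h v → 𝟏 (hasBoundary? I s (h , v)) ≈
                    𝟏 (Vec.map Vec.head h ≟ᵥ I) * boundary s (h , v)
    split h v = begin
      𝟏 (hasBoundary? I s (h , v))
        ≈⟨ 𝟏-× (left ×-dec right) (bottom ×-dec top) ⟩
      𝟏 (left ×-dec right) * 𝟏 (bottom ×-dec top)
        ≈⟨ *-cong (𝟏-× left right) (𝟏-× bottom top) ⟩
      (𝟏 left * 𝟏 right) * (𝟏 bottom * 𝟏 top)
        ≈⟨ *-assoc _ _ _ ⟩
      𝟏 left * boundary s (h , v) ∎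
      where
      left   = Vec.map Vec.head h ≟ᵥ I
      right  = Vec.map Vec.last h ≟ᵥ Vec.replicate N 0F
      bottom = Vec.head v ≟ᵥ Vec.replicate L 0F
      top    = Vec.last v ≟ᵥ s

  boundary-zipWith-∷ : ∀ {N L} t s (a : Vec State N) h b v →
    boundary {N} {suc L} (t ∷ s) (zipWith _∷_ a h , zipWith _∷_ b v) ≈
      (𝟏 (Vec.head b Fin.≟ 0F) * 𝟏 (Vec.last b Fin.≟ t)) * boundary s (h , v)
  boundary-zipWith-∷ {N} {L} t s a h b@(b₀ ∷ _) v@(v₀ ∷ _)
    rewrite map-last-zipWith-∷ a h | last-zipWith-∷ b v = begin
    right * (𝟏 (b₀ ∷ v₀ ≟ᵥ 0F ∷ Vec.replicate L 0F) * 𝟏 (Vec.last b ∷ Vec.last v ≟ᵥ t ∷ s))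
      ≈⟨ *-congˡ (*-cong (𝟏-∷ b₀ 0F v₀ _) (𝟏-∷ (Vec.last b) t (Vec.last v) s)) ⟩
    right * ((𝟏 (b₀ Fin.≟ 0F) * bottom) * (𝟏 (Vec.last b Fin.≟ t) * top))
      ≈⟨ solve 5 (λ r x b y t → r :* (x :* b :* (y :* t)) := x :* y :* (r :* (b :* t)))
               refl _ _ _ _ _ ⟩
    (𝟏 (b₀ Fin.≟ 0F) * 𝟏 (Vec.last b Fin.≟ t)) * (right * (bottom * top)) ∎
    where
    right bottom top : Carrier
    right  = 𝟏 (Vec.map Vec.last h ≟ᵥ Vec.replicate N 0F)
    bottom = 𝟏 (v₀ ≟ᵥ Vec.replicate L 0F)
    top    = 𝟏 (Vec.last v ≟ᵥ s)

  latticeWeight-zipWith-∷ : ∀ {N L} ω x (a : Vec State N) (h : Vec (Vec State (suc L)) N) b v →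
    latticeWeight ω x (zipWith _∷_ a h , zipWith _∷_ b v) ≈
      columnWeight (ω 0) x b a (Vec.map Vec.head h) * latticeWeight (ω ∘ suc) x (h , v)
  latticeWeight-zipWith-∷ {N} ω x a h b v = trans
    (∏-cong (λ r → reflexive (row r)))
    (∏-distrib-* {N} _ _)
    where
    lookup-0 : ∀ {n} (r : Vec State (suc n)) → lookup r fzero ≡ Vec.head r
    lookup-0 (_ ∷ _) = ≡.refl

    row : ∀ r →
      rowWeight ω (lookup x r) (lookup (zipWith _∷_ b v) (inject₁ r))
        (lookup (zipWith _∷_ a h) r) (lookup (zipWith _∷_ b v) (fsuc r)) ≡
      ω 0 (lookup x r) (lookup b (inject₁ r)) (lookup a r) (lookup b (fsuc r))
          (lookup (Vec.map Vec.head h) r) *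
      rowWeight (ω ∘ suc) (lookup x r) (lookup v (inject₁ r)) (lookup h r) (lookup v (fsuc r))
    row r
      rewrite Vec.lookup-zipWith _∷_ (inject₁ r) b v
            | Vec.lookup-zipWith _∷_ (fsuc r) b v
            | Vec.lookup-zipWith _∷_ r a h
            | Vec.lookup-map r Vec.head h
            | ≡.sym (lookup-0 (lookup h r)) = ≡.refl

  -- The first column acts on the left boundary as a transfer matrix, J being the
  -- labels between the first and the second column.
  partition-∷ : ∀ {N L} t (s : Vec State L) ω x (I : Vec State N) →
    partition (t ∷ s) ω x I ≈
      ∑ (words N) (λ J → column (ω 0) 0F t x I J * partition s (ω ∘ suc) x J)
  partition-∷ {N} {L} t s ω x I = begin
    partition (t ∷ s) ω x I
      ≈⟨ partition-𝟏 (t ∷ s) ω x I ⟩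
    ∑ hs′ (λ h → 𝟏 (Vec.map Vec.head h ≟ᵥ I) * ∑ vs′ (λ v → term′ (h , v)))
      ≈⟨ ∑-first-column N (suc L) _ ⟩
    ∑ (words N) (λ a → ∑ hs (λ h →
      𝟏 (Vec.map Vec.head (zipWith _∷_ a h) ≟ᵥ I) * ∑ vs′ (λ v → term′ (zipWith _∷_ a h , v))))
      ≈⟨ ∑-cong (words N) (λ a → trans
           (∑-cong hs (λ h → *-cong
             (reflexive (≡.cong (λ I′ → 𝟏 (I′ ≟ᵥ I)) (map-head-zipWith-∷ a h)))
             (peel a h)))
           (∑-*ˡ hs _ _)) ⟩
    ∑ (words N) (λ a → 𝟏 (a ≟ᵥ I) * ∑ hs (λ h → T a (Vec.map Vec.head h) * U h))
      ≈⟨ ∑-𝟏 I _ ⟩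
    ∑ hs (λ h → T I (Vec.map Vec.head h) * U h)
      ≈⟨ ∑-cong hs (λ h → sym (∑-𝟏′ (Vec.map Vec.head h) (λ J → T I J * U h))) ⟩
    ∑ hs (λ h → ∑ (words N) (λ J → 𝟏 (Vec.map Vec.head h ≟ᵥ J) * (T I J * U h)))
      ≈⟨ ∑-swap hs (words N) _ ⟩
    ∑ (words N) (λ J → ∑ hs (λ h → 𝟏 (Vec.map Vec.head h ≟ᵥ J) * (T I J * U h)))
      ≈⟨ ∑-cong (words N) (λ J → trans
           (∑-cong hs (λ h → solve 3 (λ x y z → x :* (y :* z) := y :* (x :* z)) refl _ _ _))
           (trans (∑-*ˡ hs _ _) (*-congˡ (sym (partition-𝟏 s (ω ∘ suc) x J))))) ⟩
    ∑ (words N) (λ J → T I J * partition s (ω ∘ suc) x J) ∎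
    where
    hs′ = vectors (words (suc (suc L))) N
    hs  = vectors (words (suc L)) N
    vs′ = vectors (words (suc L)) (suc N)
    vs  = vectors (words L) (suc N)

    T : Vec State N → Vec State N → Carrier
    T = column (ω 0) 0F t x

    term′ : Configuration N (suc L) → Carrier
    term′ C = boundary (t ∷ s) C * latticeWeight ω x C

    U : Vec (Vec State (suc L)) N → Carrier
    U h = ∑ vs (λ v → boundary s (h , v) * latticeWeight (ω ∘ suc) x (h , v))

    peel : ∀ a h → ∑ vs′ (λ v → term′ (zipWith _∷_ a h , v)) ≈ T a (Vec.map Vec.head h) * U h
    peel a h = begin
      ∑ vs′ (λ v → term′ (zipWith _∷_ a h , v))
        ≈⟨ ∑-first-column (suc N) L _ ⟩
      ∑ (words (suc N)) (λ b → ∑ vs (λ v → term′ (zipWith _∷_ a h , zipWith _∷_ b v)))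
        ≈⟨ ∑-cong (words (suc N)) (λ b → ∑-cong vs (λ v → trans
             (*-cong (boundary-zipWith-∷ t s a h b v) (latticeWeight-zipWith-∷ ω x a h b v))
             (solve 4 (λ x y z w → x :* y :* (z :* w) := x :* z :* (y :* w)) refl _ _ _ _))) ⟩
      ∑ (words (suc N)) (λ b → ∑ vs (λ v →
        ((𝟏 (Vec.head b Fin.≟ 0F) * 𝟏 (Vec.last b Fin.≟ t))
          * columnWeight (ω 0) x b a (Vec.map Vec.head h)) *
        (boundary s (h , v) * latticeWeight (ω ∘ suc) x (h , v))))
        ≈⟨ ∑-*-∑ (words (suc N)) vs _ _ ⟩
      _ * U h
        ≈⟨ *-congʳ (∑-columnWeight (ω 0) 0F t x a (Vec.map Vec.head h)) ⟩
      T a (Vec.map Vec.head h) * U h ∎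

  -- Ice rule: a vertex conserves the total of the labels.
  ice : ∀ {x y} i j k l → toℕ i ℕ.+ toℕ j ≢ toℕ k ℕ.+ toℕ l → W x y i j k l ≈ 0#
  ice 0F 0F 0F 0F p = contradiction ≡.refl p
  ice 0F 0F 0F (fsuc _) _ = refl
  ice 0F 0F 1F _ _ = refl
  ice 0F 0F 2F _ _ = refl
  ice 0F 1F 0F 0F _ = refl
  ice 0F 1F 0F 1F p = contradiction ≡.refl p
  ice 0F 1F 0F 2F _ = refl
  ice 0F 1F 1F 0F p = contradiction ≡.refl p
  ice 0F 1F 1F (fsuc _) _ = refl
  ice 0F 1F 2F _ _ = refl
  ice 0F 2F 0F 0F _ = refl
  ice 0F 2F 0F 1F _ = refl
  ice 0F 2F 0F 2F p = contradiction ≡.refl p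
  ice 0F 2F 1F 0F _ = refl
  ice 0F 2F 1F 1F p = contradiction ≡.refl p
  ice 0F 2F 1F 2F _ = refl
  ice 0F 2F 2F 0F p = contradiction ≡.refl p
  ice 0F 2F 2F (fsuc _) _ = refl
  ice 1F 0F 0F 0F _ = refl
  ice 1F 0F 0F 1F p = contradiction ≡.refl p
  ice 1F 0F 0F 2F _ = refl
  ice 1F 0F 1F 0F p = contradiction ≡.refl p
  ice 1F 0F 1F (fsuc _) _ = refl
  ice 1F 0F 2F _ _ = refl
  ice 1F 1F 0F 0F _ = refl
  ice 1F 1F 0F 1F _ = refl
  ice 1F 1F 0F 2F p = contradiction ≡.refl p
  ice 1F 1F 1F 0F _ = refl
  ice 1F 1F 1F 1F p = contradiction ≡.refl p
  ice 1F 1F 1F 2F _ = refl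
  ice 1F 1F 2F 0F p = contradiction ≡.refl p
  ice 1F 1F 2F (fsuc _) _ = refl
  ice 1F 2F 0F _ _ = refl
  ice 1F 2F 1F 0F _ = refl
  ice 1F 2F 1F 1F _ = refl
  ice 1F 2F 1F 2F p = contradiction ≡.refl p
  ice 1F 2F 2F 0F _ = refl
  ice 1F 2F 2F 1F p = contradiction ≡.refl p
  ice 1F 2F 2F 2F _ = refl
  ice 2F 0F 0F 0F _ = refl
  ice 2F 0F 0F 1F _ = refl
  ice 2F 0F 0F 2F p = contradiction ≡.refl p
  ice 2F 0F 1F 0F _ = refl
  ice 2F 0F 1F 1F p = contradiction ≡.refl p
  ice 2F 0F 1F 2F _ = refl
  ice 2F 0F 2F 0F p = contradiction ≡.refl p
  ice 2F 0F 2F (fsuc _) _ = refl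
  ice 2F 1F 0F _ _ = refl
  ice 2F 1F 1F 0F _ = refl
  ice 2F 1F 1F 1F _ = refl
  ice 2F 1F 1F 2F p = contradiction ≡.refl p
  ice 2F 1F 2F 0F _ = refl
  ice 2F 1F 2F 1F p = contradiction ≡.refl p
  ice 2F 1F 2F 2F _ = refl
  ice 2F 2F 0F _ _ = refl
  ice 2F 2F 1F _ _ = refl
  ice 2F 2F 2F 0F _ = refl
  ice 2F 2F 2F 1F _ = refl
  ice 2F 2F 2F 2F p = contradiction ≡.refl p

-- Columns with parameter ∞

-- The vertex weights in the limit y → ∞, and the auxiliary quantities of the
-- column identity, as expressions in a ring; Q stands for q⁻¹.
module Asymptotics {a ℓ} (R : RawRing a ℓ) (q Q : RawRing.Carrier R) where
  open RawRing R

  private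
    infixl 6 _-_
    _-_ : Carrier → Carrier → Carrier
    x - y = x + - y

  -- The weights of the vertices with i + j = k + l; other arguments are
  -- irrelevant.
  conservedWeight : (i j k l : State) → Carrier
  conservedWeight 0F 1F 1F 0F = 1# - Q * Q
  conservedWeight 1F 2F 2F 1F = 1# - Q * Q
  conservedWeight 0F 1F 0F 1F = Q * Q
  conservedWeight 1F 2F 1F 2F = Q * Q
  conservedWeight 1F 0F 0F 1F = 0#
  conservedWeight 2F 1F 1F 2F = 0#
  conservedWeight 2F 0F 1F 1F = 0#
  conservedWeight 2F 0F 0F 2F = 0#
  conservedWeight 1F 1F 2F 0F = 1# + Q
  conservedWeight 1F 1F 1F 1F = - Q
  conservedWeight 1F 1F 0F 2F = 0#
  conservedWeight 0F 2F 2F 0F = (1# - Q * Q) * (1# + Q)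
  conservedWeight 0F 2F 1F 1F = - (Q * (1# - Q) * (1# - Q) * (1# + Q))
  conservedWeight 0F 2F 0F 2F = Q * Q * Q * Q
  conservedWeight _  _  _  _  = 1#

  -- The weight at infinity.  The test is on closed labels, so that weights of
  -- given labels compute to expressions in Q.
  W∞ : (i j k l : State) → Carrier
  W∞ i j k l =
    if does (toℕ i ℕ.+ toℕ j ℕ.≟ toℕ k ℕ.+ toℕ l) then conservedWeight i j k l else 0#

  -- x ↑ i is x to the power i.
  infixr 8 _↑_
  _↑_ : Carrier → State → Carrier
  x ↑ 0F = 1#
  x ↑ 1F = x
  x ↑ 2F = x * x

  -- The coefficient of (i , I) in H is ε i (X_I)^i times that of I.
  ε : State → Carrier
  ε 0F = 1#
  ε 1F = 1# - Q
  ε 2F = 1#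

  -- γ a X is the factor in the column identity for a column with bottom label a
  -- and top label 2, whose right labels J have X_J = X.
  γ : State → Carrier → Carrier
  γ 0F X = (1# - X) * (1# + q * X)
  γ 1F X = 1# - X
  γ 2F X = 1#

  -- The contribution of the first vertex (a , i ; b , j) of a column whose
  -- remaining right labels J have X_J = X.  The remaining left labels I then have
  -- X_I = X (−q)^(2 − b), and γ b X comes from the rest of the column.
  vertexTerm : (a j : State) → Carrier → (i b : State) → Carrier
  vertexTerm a j X i b = W∞ a i b j * (ε i * (X * (- q) ↑ opposite b) ↑ i) * γ b X

  -- The sum over the labels 0, 1, 2.
  ∑₃ : (State → Carrier) → Carrier
  ∑₃ f = f 0F + (f 1F + (f 2F + 0#))

  -- The two sides of the column identity for the first vertex; (−Q)^(2 − j) X is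
  -- X_{j , J}.
  vertexSum vertexValue : (a j : State) → Carrier → Carrier
  vertexSum a j X = ∑₃ λ i → ∑₃ λ b → vertexTerm a j X i b
  vertexValue a j X = γ a ((- Q) ↑ opposite j * X) * (ε j * X ↑ j)

module InfiniteColumns {c ℓ} (𝔽 : Field c ℓ) (q : Field.Carrier 𝔽)
  (q≉0 : Field._≉_ 𝔽 q (Field.0# 𝔽)) where
  open Field 𝔽
  open IzerginKorepin 𝔽 q
  open FieldProperties 𝔽
  open PartitionFunctions 𝔽 q
  open IntegerCoefficients commutativeRing
  open SetoidReasoning setoid
  open Exp semiring using (^-homo-*)
  open Sum *-commutativeMonoid
    using () renaming (sum to ∏; sum-cong-≋ to ∏-cong; sum-replicate-idem to ∏-1)

  Q : Carrier
  Q = q ⁻¹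

  open Asymptotics rawRing q Q

  -- At this ring the expressions of Asymptotics are formal polynomials, as the ring
  -- solver needs them.
  polynomialRing : RawRing _ _
  polynomialRing = record
    { Carrier = Polynomial 3 ; _≈_ = _≡_
    ; _+_ = _:+_ ; _*_ = _:*_ ; -_ = :-_ ; 0# = 𝟘 ; 1# = 𝟙 }
  module A∞ = Asymptotics polynomialRing

  -- To use the relation q Q = 1, an identity x = y is derived from a polynomial
  -- identity x = y + (q Q − 1) t, with an explicit cofactor t.
  modulo-qQ≈1 : ∀ {x y} t → x ≈ y + (q * Q - 1#) * t → x ≈ y
  modulo-qQ≈1 {x} {y} t x≈ = begin
    x                        ≈⟨ x≈ ⟩
    y + (q * Q - 1#) * t     ≈⟨ +-congˡ (*-congʳ (+-congʳ (*-inverse q≉0))) ⟩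
    y + (1# - 1#) * t        ≈⟨ solve 2 (λ y t → y :+ (𝟙 :- 𝟙) :* t := y) refl y t ⟩
    y                        ∎

  vertex-identity : ∀ a j X → vertexSum a j X ≈ vertexValue a j X
  vertex-identity 0F 0F X = modulo-qQ≈1 _ (solve 3 (λ q Q X →
    A∞.vertexSum q Q 0F 0F X := A∞.vertexValue q Q 0F 0F X :+ (q :* Q :- 𝟙) :*
    (X :* (𝟙 :- Q :* Q) :* (𝟙 :- X :- Q :* X))) refl q Q X)
  vertex-identity 0F 1F X = modulo-qQ≈1 _ (solve 3 (λ q Q X →
    A∞.vertexSum q Q 0F 1F X := A∞.vertexValue q Q 0F 1F X :+ (q :* Q :- 𝟙) :*
    (X :* (𝟙 :- Q) :* ((𝟙 :+ q :* Q :* (𝟙 :- X)) :* (𝟙 :+ Q :* X) :+ q :* q :* Q :* X :* (𝟙 :- X)))) refl q Q X)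
  vertex-identity 0F 2F X = modulo-qQ≈1 _ (solve 3 (λ q Q X →
    A∞.vertexSum q Q 0F 2F X := A∞.vertexValue q Q 0F 2F X :+ (q :* Q :- 𝟙) :*
    (X :* X :* (𝟙 :- X) :* (𝟙 :+ q :* X) :* (𝟙 :+ q :* Q) :* (𝟙 :+ q :* q :* Q :* Q))) refl q Q X)
  vertex-identity 1F 0F X = modulo-qQ≈1 _ (solve 3 (λ q Q X →
    A∞.vertexSum q Q 1F 0F X := A∞.vertexValue q Q 1F 0F X :+ (q :* Q :- 𝟙) :* 𝟘) refl q Q X)
  vertex-identity 1F 1F X = modulo-qQ≈1 _ (solve 3 (λ q Q X →
    A∞.vertexSum q Q 1F 1F X := A∞.vertexValue q Q 1F 1F X :+ (q :* Q :- 𝟙) :*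
    (X :* (𝟙 :- Q) :* (𝟙 :- X))) refl q Q X)
  vertex-identity 1F 2F X = modulo-qQ≈1 _ (solve 3 (λ q Q X →
    A∞.vertexSum q Q 1F 2F X := A∞.vertexValue q Q 1F 2F X :+ (q :* Q :- 𝟙) :*
    (X :* X :* (𝟙 :- X) :* (𝟙 :+ q :* Q))) refl q Q X)
  vertex-identity 2F 0F X = modulo-qQ≈1 _ (solve 3 (λ q Q X →
    A∞.vertexSum q Q 2F 0F X := A∞.vertexValue q Q 2F 0F X :+ (q :* Q :- 𝟙) :* 𝟘) refl q Q X)
  vertex-identity 2F 1F X = modulo-qQ≈1 _ (solve 3 (λ q Q X →
    A∞.vertexSum q Q 2F 1F X := A∞.vertexValue q Q 2F 1F X :+ (q :* Q :- 𝟙) :* 𝟘) refl q Q X)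
  vertex-identity 2F 2F X = modulo-qQ≈1 _ (solve 3 (λ q Q X →
    A∞.vertexSum q Q 2F 2F X := A∞.vertexValue q Q 2F 2F X :+ (q :* Q :- 𝟙) :* 𝟘) refl q Q X)

  -- The denominators of the weights at (x , y) = (0 , 1).

  d∞≉0 : 0# - q ^ 2 * 1# ≉ 0#
  d∞≉0 d≈0 = *-nonzero q≉0 q≉0 (begin
    q * q                ≈⟨ solve 1 (λ q → q :* q := :- (𝟘 :- q :^ 2 :* 𝟙)) refl q ⟩
    - (0# - q ^ 2 * 1#)  ≈⟨ -‿cong d≈0 ⟩
    - 0#                 ≈⟨ solve 0 (:- 𝟘 := 𝟘) refl ⟩
    0#                   ∎)

  D∞≉0 : (0# - q ^ 2 * 1#) * (0# - q ^ 3 * 1#) ≉ 0#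
  D∞≉0 D≈0 = *-nonzero (*-nonzero q≉0 d∞≉0) d∞≉0 (begin
    q * (0# - q ^ 2 * 1#) * (0# - q ^ 2 * 1#)
      ≈⟨ solve 1 (λ q → q :* (𝟘 :- q :^ 2 :* 𝟙) :* (𝟘 :- q :^ 2 :* 𝟙)
                      := (𝟘 :- q :^ 2 :* 𝟙) :* (𝟘 :- q :^ 3 :* 𝟙)) refl q ⟩
    (0# - q ^ 2 * 1#) * (0# - q ^ 3 * 1#)
      ≈⟨ D≈0 ⟩
    0# ∎)

  -- The weights at (x , y) = (0 , 1), which is y / x = ∞.
  W-at-∞ : ∀ i j k l → W 0# 1# i j k l ≈ W∞ i j k l
  W-at-∞ i j k l = go (toℕ i ℕ.+ toℕ j ℕ.≟ toℕ k ℕ.+ toℕ l)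
    where
    W∞≈ : ∀ {b} → does (toℕ i ℕ.+ toℕ j ℕ.≟ toℕ k ℕ.+ toℕ l) ≡ b →
          W∞ i j k l ≈ (if b then conservedWeight i j k l else 0#)
    W∞≈ eq = reflexive (≡.cong (if_then conservedWeight i j k l else 0#) eq)

    over-d : ∀ {x v} t → v * (0# - q ^ 2 * 1#) ≈ x + (q * Q - 1#) * t →
             x / (0# - q ^ 2 * 1#) ≈ v
    over-d t eq = /-unique d∞≉0 (modulo-qQ≈1 t eq)
    over-D : ∀ {x v} t →
             v * ((0# - q ^ 2 * 1#) * (0# - q ^ 3 * 1#)) ≈ x + (q * Q - 1#) * t →
             x / ((0# - q ^ 2 * 1#) * (0# - q ^ 3 * 1#)) ≈ v
    over-D t eq = /-unique D∞≉0 (modulo-qQ≈1 t eq)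

    d D : ∀ {n} → Polynomial n → Polynomial n
    d q = 𝟘 :- q :^ 2 :* 𝟙
    D q = d q :* (𝟘 :- q :^ 3 :* 𝟙)

    w1010 = over-d _ (solve 2 (λ q Q → 𝟙 :* d q := q :^ 2 :* (𝟘 :- 𝟙) :+ (q :* Q :- 𝟙) :* 𝟘) refl q Q)
    w1001 = over-d _ (solve 2 (λ q Q → 𝟘 :* d q := (𝟙 :- q :^ 2) :* 𝟘 :+ (q :* Q :- 𝟙) :* 𝟘) refl q Q)
    w0110 = over-d _ (solve 2 (λ q Q → (𝟙 :- Q :* Q) :* d q
      := (𝟙 :- q :^ 2) :* 𝟙 :+ (q :* Q :- 𝟙) :* (𝟙 :+ q :* Q)) refl q Q)
    w0101 = over-d _ (solve 2 (λ q Q → Q :* Q :* d q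
      := (𝟘 :- 𝟙) :+ (q :* Q :- 𝟙) :* (:- 𝟙 :- q :* Q)) refl q Q)

    conserving : ∀ i j k l → toℕ i ℕ.+ toℕ j ≡ toℕ k ℕ.+ toℕ l →
                 W 0# 1# i j k l ≈ conservedWeight i j k l
    conserving 0F 0F 0F 0F _ = refl
    conserving 2F 2F 2F 2F _ = refl
    conserving 1F 0F 1F 0F _ = w1010
    conserving 2F 1F 2F 1F _ = w1010
    conserving 1F 0F 0F 1F _ = w1001
    conserving 2F 1F 1F 2F _ = w1001
    conserving 0F 1F 1F 0F _ = w0110
    conserving 1F 2F 2F 1F _ = w0110
    conserving 0F 1F 0F 1F _ = w0101
    conserving 1F 2F 1F 2F _ = w0101
    conserving 2F 0F 2F 0F _ = over-D _ (solve 2 (λ q Q → 𝟙 :* D q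
      := q :^ 4 :* (𝟘 :- 𝟙) :* (𝟘 :- q :* 𝟙) :+ (q :* Q :- 𝟙) :* 𝟘) refl q Q)
    conserving 2F 0F 1F 1F _ = over-D _ (solve 2 (λ q Q → 𝟘 :* D q
      := :- (q :* (𝟙 :- q) :^ 2 :* (𝟙 :+ q) :* 𝟘 :* (𝟘 :- 𝟙)) :+ (q :* Q :- 𝟙) :* 𝟘) refl q Q)
    conserving 2F 0F 0F 2F _ = over-D _ (solve 2 (λ q Q → 𝟘 :* D q
      := (𝟙 :- q :^ 2) :* 𝟘 :* (𝟘 :+ q :* 𝟘 :- q :* 𝟙 :- q :^ 3 :* 𝟙)
         :+ (q :* Q :- 𝟙) :* 𝟘) refl q Q)
    conserving 1F 1F 2F 0F _ = over-D _ (solve 2 (λ q Q → (𝟙 :+ Q) :* D q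
      := :- (q :^ 4 :* (𝟙 :+ q) :* (𝟘 :- 𝟙) :* 𝟙) :+ (q :* Q :- 𝟙) :* q :^ 4) refl q Q)
    conserving 1F 1F 1F 1F _ = over-D _ (solve 2 (λ q Q → (:- Q) :* D q
      := (:- (q :* 𝟘 :^ 2) :+ (𝟙 :+ q) :* (𝟙 :- q :^ 2 :+ q :^ 4) :* 𝟘 :* 𝟙 :- q :^ 4 :* 𝟙 :^ 2)
         :+ (q :* Q :- 𝟙) :* :- (q :^ 4)) refl q Q)
    conserving 1F 1F 0F 2F _ = over-D _ (solve 2 (λ q Q → 𝟘 :* D q
      := (𝟙 :+ q) :* 𝟘 :* (𝟘 :- 𝟙) :+ (q :* Q :- 𝟙) :* 𝟘) refl q Q)
    conserving 0F 2F 2F 0F _ = over-D _ (solve 2 (λ q Q → (𝟙 :- Q :* Q) :* (𝟙 :+ Q) :* D q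
      := (𝟙 :- q :^ 2) :* (𝟘 :+ q :^ 2 :* 𝟘 :- q :^ 2 :* 𝟙 :- q :^ 3 :* 𝟙) :* 𝟙
         :+ (q :* Q :- 𝟙) :* (:- q :^ 2 :- q :^ 3 :- q :^ 3 :* Q :+ q :^ 4 :- q :^ 4 :* Q
                                :- q :^ 4 :* Q :^ 2)) refl q Q)
    conserving 0F 2F 1F 1F _ = over-D _ (solve 2 (λ q Q →
      :- (Q :* (𝟙 :- Q) :* (𝟙 :- Q) :* (𝟙 :+ Q)) :* D q
      := q :* (𝟙 :- q) :^ 2 :* (𝟙 :+ q) :* (𝟘 :- 𝟙) :* 𝟙
         :+ (q :* Q :- 𝟙) :* (:- q :+ q :^ 2 :- q :^ 2 :* Q :+ q :^ 3 :+ q :^ 3 :* Q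
                                :- q :^ 3 :* Q :^ 2 :- q :^ 4 :+ q :^ 4 :* Q
                                :+ q :^ 4 :* Q :^ 2 :- q :^ 4 :* Q :^ 3)) refl q Q)
    conserving 0F 2F 0F 2F _ = over-D _ (solve 2 (λ q Q → Q :* Q :* Q :* Q :* D q
      := (𝟘 :- 𝟙) :* (𝟘 :- q :* 𝟙)
         :+ (q :* Q :- 𝟙) :* (q :+ q :^ 2 :* Q :+ q :^ 3 :* Q :^ 2 :+ q :^ 4 :* Q :^ 3)) refl q Q)
    conserving 1F 2F 0F 0F ()
    conserving 1F 2F 0F 1F ()
    conserving 1F 2F 0F 2F ()
    conserving 1F 2F 1F 0F ()
    conserving 1F 2F 1F 1F ()
    conserving 1F 2F 2F 0F ()
    conserving 1F 2F 2F 2F ()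
    conserving 2F 1F 0F 0F ()
    conserving 2F 1F 0F 1F ()
    conserving 2F 1F 0F 2F ()
    conserving 2F 1F 1F 0F ()
    conserving 2F 1F 1F 1F ()
    conserving 2F 1F 2F 0F ()
    conserving 2F 1F 2F 2F ()
    conserving 2F 2F 0F 0F ()
    conserving 2F 2F 0F 1F ()
    conserving 2F 2F 0F 2F ()
    conserving 2F 2F 1F 0F ()
    conserving 2F 2F 1F 1F ()
    conserving 2F 2F 1F 2F ()
    conserving 2F 2F 2F 0F ()
    conserving 2F 2F 2F 1F ()

    go : Dec (toℕ i ℕ.+ toℕ j ≡ toℕ k ℕ.+ toℕ l) → W 0# 1# i j k l ≈ W∞ i j k l
    go (no  p) = trans (ice i j k l p) (sym (W∞≈ (dec-false (_ ℕ.≟ _) p)))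
    go (yes p) = trans (conserving i j k l p) (sym (W∞≈ (dec-true (_ ℕ.≟ _) p)))

  ↑-^ : ∀ x (i : State) → x ↑ i ≈ x ^ toℕ i
  ↑-^ x 0F = refl
  ↑-^ x 1F = sym (*-identityʳ x)
  ↑-^ x 2F = *-congˡ (sym (*-identityʳ x))

  ↑-cong : ∀ {x y} (i : State) → x ≈ y → x ↑ i ≈ y ↑ i
  ↑-cong 0F x≈y = refl
  ↑-cong 1F x≈y = x≈y
  ↑-cong 2F x≈y = *-cong x≈y x≈y

  -- X_I = (−Q)^d(I), with d the deficiency.
  X : ∀ {n} → Vec State n → Carrier
  X I = (- Q) ^ deficiency I

  X-∷ : ∀ {n} i (I : Vec State n) → X (i ∷ I) ≈ (- Q) ↑ opposite i * X I
  X-∷ i I rewrite opposite-2∸ i = trans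
    (^-homo-* (- Q) (toℕ (opposite i)) (deficiency I)) (*-congʳ (sym (↑-^ (- Q) (opposite i))))

  -- The coefficient of F_S^I in H_S.
  coefficient : ∀ {n} → Vec State n → Carrier
  coefficient I = (- 1#) ^ ⌊ 𝔠₁ I /2⌋ * (1# - q ⁻¹) ^ 𝔠₁ I * (q ⁻¹) ^ inv I

  sign-square : ∀ n → (- 1#) ^ n * (- 1#) ^ n ≈ 1#
  sign-square zero    = *-identityˡ 1#
  sign-square (suc n) = trans
    (solve 1 (λ s → :- 𝟙 :* s :* (:- 𝟙 :* s) := s :* s) refl _) (sign-square n)

  -- 𝔠₁ I and the deficiency of I have the same parity.
  sign-𝔠₁ : ∀ {n} (I : Vec State n) → (- 1#) ^ 𝔠₁ I ≈ (- 1#) ^ deficiency I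
  sign-𝔠₁ []       = refl
  sign-𝔠₁ (0F ∷ I) = trans (sign-𝔠₁ I) (solve 1 (λ s → s := :- 𝟙 :* (:- 𝟙 :* s)) refl _)
  sign-𝔠₁ (1F ∷ I) = *-congˡ (sign-𝔠₁ I)
  sign-𝔠₁ (2F ∷ I) = sign-𝔠₁ I

  -- ⌊(n + 1) / 2⌋ exceeds ⌊n / 2⌋ exactly when n is odd.
  sign-⌊/2⌋ : ∀ n → (- 1#) ^ ⌊ suc n /2⌋ ≈ (- 1#) ^ ⌊ n /2⌋ * (- 1#) ^ n
  sign-⌊/2⌋ 0             = sym (*-identityˡ 1#)
  sign-⌊/2⌋ 1             = solve 0 (:- 𝟙 :* 𝟙 := 𝟙 :* (:- 𝟙 :* 𝟙)) refl
  sign-⌊/2⌋ (suc (suc n)) = trans (*-congˡ (sign-⌊/2⌋ n))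
    (solve 2 (λ s t → :- 𝟙 :* (s :* t) := :- 𝟙 :* s :* (:- 𝟙 :* (:- 𝟙 :* t))) refl _ _)

  neg-^ : ∀ x n → (- 1#) ^ n * x ^ n ≈ (- x) ^ n
  neg-^ x zero    = *-identityˡ 1#
  neg-^ x (suc n) = trans
    (solve 3 (λ s x y → :- 𝟙 :* s :* (x :* y) := :- x :* (s :* y)) refl _ x _)
    (*-congˡ (neg-^ x n))

  -- A first label i adds i d(I) to inv, and a first label 1 changes the sign by
  -- (−1)^𝔠₁(I) = (−1)^d(I); together they give X_I^i, up to ε i.
  coefficient-∷ : ∀ {n} i (I : Vec State n) →
                  coefficient (i ∷ I) ≈ ε i * X I ↑ i * coefficient I
  coefficient-∷ 0F I rewrite sum-map-* 0 I = solve 1 (λ h → h := 𝟙 :* 𝟙 :* h) refl _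
  coefficient-∷ 1F I rewrite sum-map-* 1 I | ℕ.+-identityʳ (deficiency I) = begin
    (- 1#) ^ ⌊ suc (𝔠₁ I) /2⌋ * ((1# - Q) * (1# - Q) ^ 𝔠₁ I) * Q ^ (deficiency I ℕ.+ inv I)
      ≈⟨ *-cong (*-congʳ (trans (sign-⌊/2⌋ (𝔠₁ I)) (*-congˡ (sign-𝔠₁ I)))) (^-homo-* Q (deficiency I) (inv I)) ⟩
    ((- 1#) ^ ⌊ 𝔠₁ I /2⌋ * (- 1#) ^ deficiency I) * ((1# - Q) * (1# - Q) ^ 𝔠₁ I)
      * (Q ^ deficiency I * Q ^ inv I)
      ≈⟨ solve 6 (λ s t e c d i → (s :* t) :* (e :* c) :* (d :* i) := e :* (t :* d) :* (s :* c :* i))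
               refl ((- 1#) ^ ⌊ 𝔠₁ I /2⌋) _ (1# - Q) _ _ _ ⟩
    (1# - Q) * ((- 1#) ^ deficiency I * Q ^ deficiency I) * coefficient I
      ≈⟨ *-congʳ (*-congˡ (neg-^ Q (deficiency I))) ⟩
    (1# - Q) * X I * coefficient I ∎
  coefficient-∷ 2F I rewrite sum-map-* 2 I | ℕ.+-identityʳ (deficiency I) = begin
    s * e * Q ^ ((d ℕ.+ d) ℕ.+ inv I)
      ≈⟨ *-congˡ (trans (^-homo-* Q (d ℕ.+ d) (inv I)) (*-congʳ (^-homo-* Q d d))) ⟩
    s * e * ((Q ^ d * Q ^ d) * Q ^ inv I)
      ≈⟨ solve 4 (λ s e d i → s :* e :* (d :* d :* i) := 𝟙 :* (d :* d) :* (s :* e :* i)) refl s e _ _ ⟩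
    1# * (Q ^ d * Q ^ d) * coefficient I
      ≈⟨ *-congʳ (*-cong (sym (sign-square d)) refl) ⟩
    ((- 1#) ^ d * (- 1#) ^ d) * (Q ^ d * Q ^ d) * coefficient I
      ≈⟨ *-congʳ (trans (solve 2 (λ s t → s :* s :* (t :* t) := 𝟙 :* ((s :* t) :* (s :* t))) refl _ _)
                        (*-congˡ (*-cong (neg-^ Q d) (neg-^ Q d)))) ⟩
    1# * (X I * X I) * coefficient I ∎
    where
    d = deficiency I
    s = (- 1#) ^ ⌊ 𝔠₁ I /2⌋
    e = (1# - Q) ^ 𝔠₁ I

  -- The weights of a column whose parameter is ∞.
  infinite : Carrier → Weight
  infinite _ = W 0# 1#

  -- A column vanishes unless its bottom and left labels have the same total as its
  -- top and right labels.
  column-conserves : ∀ {n} a t xs (I J : Vec State n) →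
    toℕ a ℕ.+ ∣ I ∣ᵥ ≢ toℕ t ℕ.+ ∣ J ∣ᵥ → column infinite a t xs I J ≈ 0#
  column-conserves a t [] [] [] p with a Fin.≟ t
  ... | yes ≡.refl = contradiction ≡.refl p
  ... | no _       = refl
  column-conserves a t (x ∷ xs) (i ∷ I) (j ∷ J) p = ∑-zero states vanish
    where
    vanish : ∀ b → W 0# 1# a i b j * column infinite b t xs I J ≈ 0#
    vanish b with toℕ a ℕ.+ toℕ i ℕ.≟ toℕ b ℕ.+ toℕ j | toℕ b ℕ.+ ∣ I ∣ᵥ ℕ.≟ toℕ t ℕ.+ ∣ J ∣ᵥ
    ... | no p₁ | _      = trans (*-congʳ (ice a i b j p₁)) (zeroˡ _)
    ... | yes _ | no p₂  = trans (*-congˡ (column-conserves b t xs I J p₂)) (zeroʳ _)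
    ... | yes e₁ | yes e₂ = contradiction
      (balance-∷ (toℕ a) (toℕ i) (toℕ b) (toℕ j) (toℕ t) ∣ I ∣ᵥ ∣ J ∣ᵥ e₁ e₂) p

  ↑-inverse : ∀ o → (- Q) ↑ o * (- q) ↑ o ≈ 1#
  ↑-inverse 0F = *-identityˡ 1#
  ↑-inverse 1F = modulo-qQ≈1 1# (solve 2 (λ q Q →
    :- Q :* :- q := 𝟙 :+ (q :* Q :- 𝟙) :* 𝟙) refl q Q)
  ↑-inverse 2F = modulo-qQ≈1 (1# + q * Q) (solve 2 (λ q Q →
    (:- Q :* :- Q) :* (:- q :* :- q) := 𝟙 :+ (q :* Q :- 𝟙) :* (𝟙 :+ q :* Q)) refl q Q)

  -- The relation between X_I and X_J on the two sides of a column with bottom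
  -- label b and top label 2.
  X-balance : ∀ {n} (b : State) (I J : Vec State n) →
    toℕ b ℕ.+ ∣ I ∣ᵥ ≡ 2 ℕ.+ ∣ J ∣ᵥ → X I ≈ X J * (- q) ↑ opposite b
  X-balance b I J eq = begin
    X I
      ≈⟨ sym (trans (*-congˡ (↑-inverse (opposite b))) (*-identityʳ _)) ⟩
    X I * ((- Q) ↑ opposite b * (- q) ↑ opposite b)
      ≈⟨ solve 3 (λ x y z → x :* (y :* z) := y :* x :* z) refl _ _ _ ⟩
    (- Q) ↑ opposite b * X I * (- q) ↑ opposite b
      ≈⟨ *-congʳ (*-congʳ (↑-^ (- Q) (opposite b))) ⟩
    (- Q) ^ toℕ (opposite b) * X I * (- q) ↑ opposite b
      ≈⟨ *-congʳ (sym (^-homo-* (- Q) (toℕ (opposite b)) (deficiency I))) ⟩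
    (- Q) ^ (toℕ (opposite b) ℕ.+ deficiency I) * (- q) ↑ opposite b
      ≡⟨ ≡.cong (λ d → (- Q) ^ d * (- q) ↑ opposite b) (≡.sym d≡) ⟩
    X J * (- q) ↑ opposite b ∎
    where
    d≡ : deficiency J ≡ toℕ (opposite b) ℕ.+ deficiency I
    d≡ = ℕ.+-cancelˡ-≡ (toℕ b) _ _
      (≡.trans (deficiency-balance b 2F I J eq)
        (≡.trans (≡.cong (ℕ._+ deficiency I) (≡.sym (toℕ+opposite b)))
          (ℕ.+-assoc (toℕ b) _ _)))

  γ-cong : ∀ a {x y} → x ≈ y → γ a x ≈ γ a y
  γ-cong 0F x≈y = *-cong (+-congˡ (-‿cong x≈y)) (+-congˡ (*-congˡ x≈y))
  γ-cong 1F x≈y = +-congˡ (-‿cong x≈y)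
  γ-cong 2F x≈y = refl

  -- The vector of coefficients is reproduced by the transfer matrix of a column at
  -- infinity with top label 2.
  column-identity : ∀ {n} a xs (J : Vec State n) →
    ∑ (words n) (λ I → coefficient I * column infinite a 2F xs I J) ≈ γ a (X J) * coefficient J
  column-identity 0F [] [] =
    solve 2 (λ q h → h :* 𝟘 :+ 𝟘 := (𝟙 :- 𝟙) :* (𝟙 :+ q :* 𝟙) :* h) refl q _
  column-identity 1F [] [] = solve 1 (λ h → h :* 𝟘 :+ 𝟘 := (𝟙 :- 𝟙) :* h) refl _
  column-identity 2F [] [] = solve 1 (λ h → h :* 𝟙 :+ 𝟘 := 𝟙 :* h) refl _
  column-identity {suc n} a (x ∷ xs) (j ∷ J) = begin
    ∑ (words (suc n)) (λ I → coefficient I * column infinite a 2F (x ∷ xs) I (j ∷ J))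
      ≈⟨ ∑-vectors states n _ ⟩
    ∑ states (λ i → ∑ (words n) (λ I →
      coefficient (i ∷ I) * ∑ states (λ b → W 0# 1# a i b j * T b I)))
      ≈⟨ ∑-cong states first-label ⟩
    ∑ states (λ i → ∑ states (vertexTerm a j (X J) i) * coefficient J)
      ≈⟨ ∑-*ʳ states (λ i → ∑ states (vertexTerm a j (X J) i)) (coefficient J) ⟩
    vertexSum a j (X J) * coefficient J
      ≈⟨ *-congʳ (vertex-identity a j (X J)) ⟩
    γ a ((- Q) ↑ opposite j * X J) * (ε j * X J ↑ j) * coefficient J
      ≈⟨ *-assoc _ _ _ ⟩
    γ a ((- Q) ↑ opposite j * X J) * (ε j * X J ↑ j * coefficient J)
      ≈⟨ *-cong (γ-cong a (sym (X-∷ j J))) (sym (coefficient-∷ j J)) ⟩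
    γ a (X (j ∷ J)) * coefficient (j ∷ J) ∎
    where
    T : State → Vec State n → Carrier
    T b I = column infinite b 2F xs I J

    A : State → State → Carrier
    A i b = W∞ a i b j * (ε i * (X J * (- q) ↑ opposite b) ↑ i)

    -- Where T b I is nonzero, X_I is determined by X_J and b.
    term : ∀ i I b → coefficient (i ∷ I) * (W 0# 1# a i b j * T b I) ≈
                     A i b * (coefficient I * T b I)
    term i I b with toℕ b ℕ.+ ∣ I ∣ᵥ ℕ.≟ 2 ℕ.+ ∣ J ∣ᵥ
    ... | no p = begin
      coefficient (i ∷ I) * (W 0# 1# a i b j * T b I)
        ≈⟨ *-congˡ (*-congˡ (column-conserves b 2F xs I J p)) ⟩
      coefficient (i ∷ I) * (W 0# 1# a i b j * 0#)
        ≈⟨ solve 4 (λ h w a k → h :* (w :* 𝟘) := a :* (k :* 𝟘)) refl _ _ (A i b) (coefficient I) ⟩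
      A i b * (coefficient I * 0#)
        ≈⟨ *-congˡ (*-congˡ (sym (column-conserves b 2F xs I J p))) ⟩
      A i b * (coefficient I * T b I) ∎
    ... | yes p = begin
      coefficient (i ∷ I) * (W 0# 1# a i b j * T b I)
        ≈⟨ *-cong (coefficient-∷ i I) (*-congʳ (W-at-∞ a i b j)) ⟩
      (ε i * X I ↑ i * coefficient I) * (W∞ a i b j * T b I)
        ≈⟨ solve 5 (λ e x h w t → (e :* x :* h) :* (w :* t) := (w :* (e :* x)) :* (h :* t)) refl
             (ε i) (X I ↑ i) (coefficient I) (W∞ a i b j) (T b I) ⟩
      (W∞ a i b j * (ε i * X I ↑ i)) * (coefficient I * T b I)
        ≈⟨ *-congʳ (*-congˡ (*-congˡ (↑-cong i (X-balance b I J p)))) ⟩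
      A i b * (coefficient I * T b I) ∎

    first-label : ∀ i →
      ∑ (words n) (λ I → coefficient (i ∷ I) * ∑ states (λ b → W 0# 1# a i b j * T b I)) ≈
      ∑ states (vertexTerm a j (X J) i) * coefficient J
    first-label i = begin
      ∑ (words n) (λ I → coefficient (i ∷ I) * ∑ states (λ b → W 0# 1# a i b j * T b I))
        ≈⟨ ∑-cong (words n) (λ I → trans
             (sym (∑-*ˡ states (coefficient (i ∷ I)) (λ b → W 0# 1# a i b j * T b I)))
             (∑-cong states (term i I))) ⟩
      ∑ (words n) (λ I → ∑ states (λ b → A i b * (coefficient I * T b I)))
        ≈⟨ ∑-swap (words n) states (λ I b → A i b * (coefficient I * T b I)) ⟩
      ∑ states (λ b → ∑ (words n) (λ I → A i b * (coefficient I * T b I)))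
        ≈⟨ ∑-cong states (λ b → trans
             (∑-*ˡ (words n) (A i b) (λ I → coefficient I * T b I))
             (trans (*-congˡ (column-identity b xs J)) (sym (*-assoc (A i b) (γ b (X J)) _)))) ⟩
      ∑ states (λ b → vertexTerm a j (X J) i b * coefficient J)
        ≈⟨ ∑-*ʳ states (vertexTerm a j (X J) i) (coefficient J) ⟩
      ∑ states (vertexTerm a j (X J) i) * coefficient J ∎

  -- The sum of coefficient I * f I over |I| = 2K; H K S x z is the case
  -- f I = F_S^I.
  Hsum : ∀ {n} → ℕ → (Vec State n → Carrier) → Carrier
  Hsum {n} K f =
    ∑ (List.filter (λ I → ∣ I ∣ᵥ ℕ.≟ 2 ℕ.* K) (words n)) (λ I → coefficient I * f I)

  Hsum-cong : ∀ {n} K {f g : Vec State n → Carrier} → (∀ I → f I ≈ g I) → Hsum K f ≈ Hsum K g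
  Hsum-cong {n} K f≈g =
    ∑-cong (List.filter (λ I → ∣ I ∣ᵥ ℕ.≟ 2 ℕ.* K) (words n)) (λ I → *-congˡ (f≈g I))

  Hsum-𝟏 : ∀ {n} K (f : Vec State n → Carrier) →
           Hsum K f ≈ ∑ (words n) (λ I → 𝟏 (∣ I ∣ᵥ ℕ.≟ 2 ℕ.* K) * (coefficient I * f I))
  Hsum-𝟏 K f = ∑-filter (λ I → ∣ I ∣ᵥ ℕ.≟ 2 ℕ.* K) (words _) (λ I → coefficient I * f I)

  Hsum-unique : ∀ {n} K (f : Vec State n → Carrier) (I₀ : Vec State n) →
    (∀ I → ∣ I ∣ᵥ ≡ 2 ℕ.* K → I ≡ I₀) → ∣ I₀ ∣ᵥ ≡ 2 ℕ.* K →
    Hsum K f ≈ coefficient I₀ * f I₀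
  Hsum-unique {n} K f I₀ unique eq = trans (Hsum-𝟏 K f) (trans
    (∑-cong (words n) (λ I → *-congʳ
      (𝟏-⇔ (unique I) (λ { ≡.refl → eq }) (∣ I ∣ᵥ ℕ.≟ 2 ℕ.* K) (I ≟ᵥ I₀))))
    (∑-𝟏 I₀ (λ I → coefficient I * f I)))

  -- The factor γ₀(X_J) for J of deficiency 2m.
  eigenvalue : ℕ → Carrier
  eigenvalue m = γ 0F ((- Q) ^ (m ℕ.+ m))

  -- Removing a first column at infinity.
  Hsum-column : ∀ {n L} K m (s : Vec State L) ω x → m ℕ.+ K ≡ n → ω 0 ≡ infinite →
    Hsum {n} (suc K) (partition (2F ∷ s) ω x) ≈
    eigenvalue m * Hsum K (partition s (ω ∘ suc) x)
  Hsum-column {n} K m s ω x m+K≡n ω₀ = begin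
    Hsum (suc K) (partition (2F ∷ s) ω x)
      ≈⟨ Hsum-𝟏 (suc K) (partition (2F ∷ s) ω x) ⟩
    ∑ (words n) (λ I → 𝟏 (∣ I ∣ᵥ ℕ.≟ 2 ℕ.* suc K) * (coefficient I * partition (2F ∷ s) ω x I))
      ≈⟨ ∑-cong (words n) (λ I → trans
           (*-congˡ (trans (*-congˡ (transfer I))
             (sym (∑-*ˡ (words n) (coefficient I) (λ J → T I J * P J)))))
           (sym (∑-*ˡ (words n) (𝟏 (∣ I ∣ᵥ ℕ.≟ 2 ℕ.* suc K)) (λ J → coefficient I * (T I J * P J))))) ⟩
    ∑ (words n) (λ I → ∑ (words n) (λ J →
      𝟏 (∣ I ∣ᵥ ℕ.≟ 2 ℕ.* suc K) * (coefficient I * (T I J * P J))))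
      ≈⟨ ∑-cong (words n) (λ I → ∑-cong (words n) (shift I)) ⟩
    ∑ (words n) (λ I → ∑ (words n) (λ J → 𝟏 (∣ J ∣ᵥ ℕ.≟ 2 ℕ.* K) * P J * (coefficient I * T I J)))
      ≈⟨ ∑-swap (words n) (words n) _ ⟩
    ∑ (words n) (λ J → ∑ (words n) (λ I → 𝟏 (∣ J ∣ᵥ ℕ.≟ 2 ℕ.* K) * P J * (coefficient I * T I J)))
      ≈⟨ ∑-cong (words n) (λ J → trans
           (∑-*ˡ (words n) (𝟏 (∣ J ∣ᵥ ℕ.≟ 2 ℕ.* K) * P J) (λ I → coefficient I * T I J))
           (*-congˡ (column-identity 0F x J))) ⟩
    ∑ (words n) (λ J → 𝟏 (∣ J ∣ᵥ ℕ.≟ 2 ℕ.* K) * P J * (γ 0F (X J) * coefficient J))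
      ≈⟨ ∑-cong (words n) eigen ⟩
    ∑ (words n) (λ J → eigenvalue m * (𝟏 (∣ J ∣ᵥ ℕ.≟ 2 ℕ.* K) * (coefficient J * P J)))
      ≈⟨ ∑-*ˡ (words n) (eigenvalue m) _ ⟩
    eigenvalue m * ∑ (words n) (λ J → 𝟏 (∣ J ∣ᵥ ℕ.≟ 2 ℕ.* K) * (coefficient J * P J))
      ≈⟨ *-congˡ (sym (Hsum-𝟏 K P)) ⟩
    eigenvalue m * Hsum K P ∎
    where
    T : Vec State n → Vec State n → Carrier
    T I J = column infinite 0F 2F x I J

    P : Vec State n → Carrier
    P = partition s (ω ∘ suc) x

    transfer : ∀ I → partition (2F ∷ s) ω x I ≈ ∑ (words n) (λ J → T I J * P J)
    transfer I = trans (partition-∷ 2F s ω x I)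
      (reflexive (≡.cong (λ w → ∑ (words n) (λ J → column w 0F 2F x I J * P J)) ω₀))

    2*suc : 2 ℕ.* suc K ≡ 2 ℕ.+ 2 ℕ.* K
    2*suc = ≡.cong suc (ℕ.+-suc K (K ℕ.+ 0))

    -- The column conserves labels, so |I| = 2(K + 1) amounts to |J| = 2K.
    shift : ∀ I J → 𝟏 (∣ I ∣ᵥ ℕ.≟ 2 ℕ.* suc K) * (coefficient I * (T I J * P J)) ≈
                    𝟏 (∣ J ∣ᵥ ℕ.≟ 2 ℕ.* K) * P J * (coefficient I * T I J)
    shift I J with ∣ I ∣ᵥ ℕ.≟ 2 ℕ.+ ∣ J ∣ᵥ
    ... | no p = begin
      𝟏 (∣ I ∣ᵥ ℕ.≟ 2 ℕ.* suc K) * (coefficient I * (T I J * P J))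
        ≈⟨ *-congˡ (*-congˡ (*-congʳ (column-conserves 0F 2F x I J p))) ⟩
      𝟏 (∣ I ∣ᵥ ℕ.≟ 2 ℕ.* suc K) * (coefficient I * (0# * P J))
        ≈⟨ solve 4 (λ y h p z → y :* (h :* (𝟘 :* p)) := z :* p :* (h :* 𝟘)) refl _ _ _ _ ⟩
      𝟏 (∣ J ∣ᵥ ℕ.≟ 2 ℕ.* K) * P J * (coefficient I * 0#)
        ≈⟨ *-congˡ (*-congˡ (sym (column-conserves 0F 2F x I J p))) ⟩
      𝟏 (∣ J ∣ᵥ ℕ.≟ 2 ℕ.* K) * P J * (coefficient I * T I J) ∎
    ... | yes p = trans
      (*-congʳ (𝟏-⇔
        (λ eq → ℕ.+-cancelˡ-≡ 2 _ _ (≡.trans (≡.sym p) (≡.trans eq 2*suc)))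
        (λ eq → ≡.trans p (≡.trans (≡.cong (2 ℕ.+_) eq) (≡.sym 2*suc)))
        (∣ I ∣ᵥ ℕ.≟ 2 ℕ.* suc K) (∣ J ∣ᵥ ℕ.≟ 2 ℕ.* K)))
      (solve 4 (λ y h t p → y :* (h :* (t :* p)) := y :* p :* (h :* t)) refl _ _ _ _)

    eigen : ∀ J → 𝟏 (∣ J ∣ᵥ ℕ.≟ 2 ℕ.* K) * P J * (γ 0F (X J) * coefficient J) ≈
                  eigenvalue m * (𝟏 (∣ J ∣ᵥ ℕ.≟ 2 ℕ.* K) * (coefficient J * P J))
    eigen J = begin
      𝟏 J? * P J * (γ 0F (X J) * coefficient J)
        ≈⟨ solve 4 (λ y p g h → y :* p :* (g :* h) := y :* g :* (h :* p)) refl _ _ _ _ ⟩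
      𝟏 J? * γ 0F (X J) * (coefficient J * P J)
        ≈⟨ *-congʳ (𝟏-*-cong J? (λ eq → γ-cong 0F
             (reflexive (≡.cong ((- Q) ^_) (deficiency-value J {m} {K} m+K≡n eq))))) ⟩
      𝟏 J? * eigenvalue m * (coefficient J * P J)
        ≈⟨ solve 3 (λ y g h → y :* g :* h := g :* (y :* h)) refl _ _ _ ⟩
      eigenvalue m * (𝟏 J? * (coefficient J * P J)) ∎
      where J? = ∣ J ∣ᵥ ℕ.≟ 2 ℕ.* K

  coefficient-twos : ∀ n → coefficient (twos n) ≈ 1#
  coefficient-twos zero    = solve 0 (𝟙 :* 𝟙 :* 𝟙 := 𝟙) refl
  coefficient-twos (suc n) = begin
    coefficient (2F ∷ twos n)
      ≈⟨ coefficient-∷ 2F (twos n) ⟩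
    1# * (X (twos n) * X (twos n)) * coefficient (twos n)
      ≈⟨ *-cong (*-congˡ (*-cong X≈1 X≈1)) (coefficient-twos n) ⟩
    1# * (1# * 1#) * 1#
      ≈⟨ solve 0 (𝟙 :* (𝟙 :* 𝟙) :* 𝟙 := 𝟙) refl ⟩
    1# ∎
    where
    X≈1 : X (twos n) ≈ 1#
    X≈1 = reflexive (≡.cong ((- Q) ^_) (deficiency-twos n))

  coefficient-zeros : ∀ n → coefficient (zeros n) ≈ 1#
  coefficient-zeros zero    = solve 0 (𝟙 :* 𝟙 :* 𝟙 := 𝟙) refl
  coefficient-zeros (suc n) = trans (coefficient-∷ 0F (zeros n))
    (trans (*-congˡ (coefficient-zeros n)) (solve 0 (𝟙 :* 𝟙 :* 𝟙 := 𝟙) refl))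

  -- The weights of a column whose parameter is y.
  finite : Carrier → Carrier → Weight
  finite y x = W x y

  Fᴵ≈partition : ∀ {N} I S (x : Vec Carrier N) z →
    Fᴵ I S x z ≈ partition (prefix (bound S) (entry S)) (finite ∘ z) x I
  Fᴵ≈partition {N} I S x z = ∑-cong
    (List.filter (hasBoundary? I (prefix (bound S) (entry S))) (configurations N (bound S)))
    (λ (h , v) → ∏-cong (λ r → ∏-cong (λ k →
      reflexive (≡.cong
      (λ y → W (lookup x r) y
        (lookup (lookup v (inject₁ r)) k) (lookup (lookup h r) (inject₁ k))
        (lookup (lookup v (fsuc r)) k) (lookup (lookup h r) (fsuc k)))
      (Vec.lookup∘tabulate (z ∘ toℕ) k)))))

  Hsum-twos : ∀ n (f : Vec State n → Carrier) → Hsum n f ≈ f (twos n)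
  Hsum-twos n f = trans (Hsum-unique n f (twos n) ∣∣≡2n⇒twos (∣twos∣ n))
    (trans (*-congʳ (coefficient-twos n)) (*-identityˡ _))

  -- The factor contributed by n columns at infinity, the right labels of the first
  -- of which have deficiency 2m.
  norm : ℕ → ℕ → Carrier
  norm zero    m = 1#
  norm (suc n) m = eigenvalue m * norm n (suc m)

  infinities : ∀ n → Vec (Carrier → Weight) n
  infinities n = Vec.replicate n infinite

  -- The right labels of the first of n columns have |J| = 2(n − 1 + K), so their
  -- deficiency is 2m with m = N + 1 − (n + K).
  Hsum-infinities : ∀ {N} n K m (S : TwoString) ω x → m ℕ.+ (n ℕ.+ K) ≡ suc N →
    Hsum {N} (n ℕ.+ K) (partition (prefix (n ℕ.+ bound S) (twos n ∪ entry S)) (infinities n ∪ ω) x)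
      ≈ norm n m * Hsum K (partition (prefix (bound S) (entry S)) ω x)
  Hsum-infinities zero    K m S ω x eq = sym (*-identityˡ _)
  Hsum-infinities (suc n) K m S ω x eq = begin
    Hsum (suc (n ℕ.+ K)) (partition (2F ∷ prefix (n ℕ.+ bound S) (twos n ∪ entry S))
                                    (infinities (suc n) ∪ ω) x)
      ≈⟨ Hsum-column (n ℕ.+ K) m _ (infinities (suc n) ∪ ω) x (ℕ.suc-injective eq′) ≡.refl ⟩
    eigenvalue m * Hsum (n ℕ.+ K) (partition (prefix (n ℕ.+ bound S) (twos n ∪ entry S))
                                             (infinities n ∪ ω) x)
      ≈⟨ *-congˡ (Hsum-infinities n K (suc m) S ω x eq′) ⟩
    eigenvalue m * (norm n (suc m) * Hsum K (partition (prefix (bound S) (entry S)) ω x))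
      ≈⟨ sym (*-assoc _ _ _) ⟩
    norm (suc n) m * Hsum K (partition (prefix (bound S) (entry S)) ω x) ∎
    where
    eq′ : suc (m ℕ.+ (n ℕ.+ K)) ≡ suc _
    eq′ = ≡.trans (≡.sym (ℕ.+-suc m (n ℕ.+ K))) eq

  -- For N = n + K, the factor norm n 1 does not depend on K.
  partition-infinities : ∀ {N} n K (S : TwoString) x z → n ℕ.+ K ≡ N →
    partition (prefix (bound (2^ n ∪ S)) (entry (2^ n ∪ S))) (infinities n ∪ finite ∘ z) x (twos N)
      ≈ norm n 1 * H K S x z
  partition-infinities n K S x z ≡.refl = begin
    partition (prefix (bound (2^ n ∪ S)) (entry (2^ n ∪ S))) (infinities n ∪ finite ∘ z) x (twos (n ℕ.+ K))
      ≈⟨ sym (Hsum-twos (n ℕ.+ K) (partition (prefix (bound (2^ n ∪ S)) (entry (2^ n ∪ S)))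
           (infinities n ∪ finite ∘ z) x)) ⟩
    Hsum (n ℕ.+ K) (partition (prefix (n ℕ.+ bound S) (twos n ∪ entry S)) (infinities n ∪ finite ∘ z) x)
      ≈⟨ Hsum-infinities n K 1 S (finite ∘ z) x ≡.refl ⟩
    norm n 1 * Hsum K (partition (prefix (bound S) (entry S)) (finite ∘ z) x)
      ≈⟨ *-congˡ (Hsum-cong K (λ I → sym (Fᴵ≈partition I S x z))) ⟩
    norm n 1 * H K S x z ∎

  ∑-rows-[] : ∀ n (f : Vec (Vec State 0) n → Carrier) →
              ∑ (vectors (words 0) n) f ≈ f (Vec.replicate n [])
  ∑-rows-[] zero    f = +-identityʳ _
  ∑-rows-[] (suc n) f = trans (∑-vectors (words 0) n f)
    (trans (+-identityʳ _) (∑-rows-[] n (f ∘ ([] ∷_))))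

  -- With no columns the right boundary is the left one, and the weight is 1.
  partition-[] : ∀ {N} ω x → partition {N} [] ω x (zeros N) ≈ 1#
  partition-[] {N} ω x = begin
    partition [] ω x (zeros N)
      ≈⟨ partition-𝟏 [] ω x (zeros N) ⟩
    ∑ (vectors (words 1) N) (λ h → 𝟏 (Vec.map Vec.head h ≟ᵥ zeros N) * U h)
      ≈⟨ ∑-first-column N 0 _ ⟩
    ∑ (words N) (λ a → ∑ (vectors (words 0) N) (λ m →
      𝟏 (Vec.map Vec.head (zipWith _∷_ a m) ≟ᵥ zeros N) * U (zipWith _∷_ a m)))
      ≈⟨ ∑-cong (words N) (λ a → trans (∑-rows-[] N _) (*-congʳ
           (reflexive (≡.cong (λ I → 𝟏 (I ≟ᵥ zeros N)) (map-head-zipWith-∷ a (Vec.replicate N [])))))) ⟩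
    ∑ (words N) (λ a → 𝟏 (a ≟ᵥ zeros N) * U (zipWith _∷_ a (Vec.replicate N [])))
      ≈⟨ ∑-𝟏 (zeros N) (λ a → U (zipWith _∷_ a (Vec.replicate N []))) ⟩
    U h₀
      ≈⟨ ∑-rows-[] (suc N) _ ⟩
    boundary [] (h₀ , v₀) * latticeWeight ω x (h₀ , v₀)
      ≈⟨ *-cong boundary≈1 (latticeWeight≈1 N) ⟩
    1# * 1#
      ≈⟨ *-identityˡ 1# ⟩
    1# ∎
    where
    U : Vec (Vec State 1) N → Carrier
    U h = ∑ (vectors (words 0) (suc N)) (λ v → boundary [] (h , v) * latticeWeight ω x (h , v))
    h₀ = zipWith _∷_ (zeros N) (Vec.replicate N [])
    v₀ = Vec.replicate (suc N) []

    last-zeros : ∀ n → Vec.map Vec.last (zipWith _∷_ (zeros n) (Vec.replicate n [])) ≡ zeros n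
    last-zeros zero    = ≡.refl
    last-zeros (suc n) = ≡.cong (0F ∷_) (last-zeros n)

    𝟏≈1 : ∀ {p} {P : Set p} (P? : Dec P) → P → 𝟏 P? ≈ 1#
    𝟏≈1 (yes _) _ = refl
    𝟏≈1 (no ¬p) p = contradiction p ¬p

    []-unique : ∀ (u v : Vec State 0) → u ≡ v
    []-unique [] [] = ≡.refl

    boundary≈1 : boundary [] (h₀ , v₀) ≈ 1#
    boundary≈1 = trans
      (*-cong (𝟏≈1 (Vec.map Vec.last h₀ ≟ᵥ zeros N) (last-zeros N))
        (*-cong (𝟏≈1 (Vec.head v₀ ≟ᵥ []) ([]-unique _ _))
                (𝟏≈1 (Vec.last v₀ ≟ᵥ []) ([]-unique _ _))))
      (solve 0 (𝟙 :* (𝟙 :* 𝟙) := 𝟙) refl)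

    latticeWeight≈1 : ∀ n → ∏ {n} (λ _ → 1#) ≈ 1#
    latticeWeight≈1 zero    = refl
    latticeWeight≈1 (suc n) = ∏-1 (*-identityˡ 1#) (suc n)

  H-∅ : ∀ {N} (x : Vec Carrier N) z → H 0 ∅ x z ≈ 1#
  H-∅ {N} x z = begin
    H 0 ∅ x z
      ≈⟨ Hsum-unique 0 (λ I → Fᴵ I ∅ x z) (zeros N) ∣∣≡0⇒zeros (∣zeros∣ N) ⟩
    coefficient (zeros N) * Fᴵ (zeros N) ∅ x z
      ≈⟨ *-cong (coefficient-zeros N) (trans (Fᴵ≈partition (zeros N) ∅ x z) (partition-[] (finite ∘ z) x)) ⟩
    1# * 1#
      ≈⟨ *-identityˡ 1# ⟩
    1# ∎

  module _ (qᵏ≉1 : ∀ k → q ^ suc k ≉ 1#) where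
    ^-inverse : ∀ k → q ^ k * Q ^ k ≈ 1#
    ^-inverse zero    = *-identityˡ 1#
    ^-inverse (suc k) = trans
      (solve 4 (λ q Q s t → q :* s :* (Q :* t) := (q :* Q) :* (s :* t)) refl q Q _ _)
      (trans (*-cong (*-inverse q≉0) (^-inverse k)) (*-identityˡ 1#))

    -- With Y = Q^(k + 1), k = 2m + 1, the eigenvalue is (1 − Y)(1 + q Y).  A zero
    -- would give q^(k + 1) = 1 or q^k = −1, hence q^(2k) = 1.
    eigenvalue≉0 : ∀ m → eigenvalue (suc m) ≉ 0#
    eigenvalue≉0 m = *-nonzero 1-Y≉0 1+qY≉0
      where
      k : ℕ
      k = m ℕ.+ suc m

      Y p : Carrier
      Y = (- Q) ^ suc k
      p = q ^ k

      Y≈ : Y ≈ Q ^ suc k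
      Y≈ = trans (sym (neg-^ Q (suc k)))
        (trans (*-congʳ (trans (^-homo-* (- 1#) (suc m) (suc m)) (sign-square (suc m)))) (*-identityˡ _))

      1-Y≉0 : 1# - Y ≉ 0#
      1-Y≉0 eq = qᵏ≉1 k (begin
        q ^ suc k                       ≈⟨ solve 2 (λ a y → a := a :* (𝟙 :- y) :+ a :* y) refl (q ^ suc k) Y ⟩
        q ^ suc k * (1# - Y) + q ^ suc k * Y
          ≈⟨ +-cong (trans (*-congˡ eq) (zeroʳ _)) (trans (*-congˡ Y≈) (^-inverse (suc k))) ⟩
        0# + 1#                         ≈⟨ +-identityˡ 1# ⟩
        1#                              ∎)

      pqY≈1 : p * (q * Y) ≈ 1#
      pqY≈1 = trans
        (trans (solve 3 (λ p q y → p :* (q :* y) := (q :* p) :* y) refl p q Y) (*-congˡ Y≈))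
        (^-inverse (suc k))

      1+qY≉0 : 1# + q * Y ≉ 0#
      1+qY≉0 eq = qᵏ≉1 (ℕ.pred (k ℕ.+ k)) (begin
        q ^ suc (ℕ.pred (k ℕ.+ k))      ≡⟨ ≡.cong (q ^_) k+k≡ ⟩
        q ^ (k ℕ.+ k)                   ≈⟨ ^-homo-* q k k ⟩
        p * p                           ≈⟨ *-cong p≈-1 p≈-1 ⟩
        - 1# * - 1#                     ≈⟨ solve 0 (:- 𝟙 :* :- 𝟙 := 𝟙) refl ⟩
        1#                              ∎)
        where
        k+k≡ : suc (ℕ.pred (k ℕ.+ k)) ≡ k ℕ.+ k
        k+k≡ rewrite ℕ.+-suc m m = ≡.refl
        p≈-1 : p ≈ - 1#
        p≈-1 = begin
          p                                    ≈⟨ solve 2 (λ p y → p := p :* (𝟙 :+ y) :- p :* y) refl p (q * Y) ⟩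
          p * (1# + q * Y) - p * (q * Y)       ≈⟨ +-cong (trans (*-congˡ eq) (zeroʳ p)) (-‿cong pqY≈1) ⟩
          0# - 1#                              ≈⟨ +-identityˡ _ ⟩
          - 1#                                 ∎

    norm≉0 : ∀ n m → norm n (suc m) ≉ 0#
    norm≉0 zero    m = 1≉0
    norm≉0 (suc n) m = *-nonzero (eigenvalue≉0 m) (norm≉0 n (suc m))

-- The limits of the weights and of F

module LimitOfF {c ℓ r ρ₁ ρ₂} (V : ValuedField c ℓ r ρ₁ ρ₂)
  (q : ValuedField.Carrier V)
  (q≉0 : ValuedField._≉_ V q (ValuedField.0# V)) where
  open ValuedField V
  open Limits V
  open IzerginKorepin scalars q
  open FieldProperties scalars
  open LimitProperties V
  open PartitionFunctions scalars q
  open IntegerCoefficients commutativeRing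
  open InfiniteColumns scalars q q≉0
  open Sum *-commutativeMonoid using () renaming (sum to ∏)

  -- The limit of a fraction after expansion by s.
  limit-fraction : ∀ {n d : Carrier → Carrier} {a b} (s : Carrier → Carrier) → b ≉ 0# →
    Limit (λ u → n u * s u) a → Limit (λ u → d u * s u) b → Limit (λ u → n u / d u) (a / b)
  limit-fraction {n} s b≉0 ns→a ds→b = limit-cong
    (eventually-map (λ u du*su≉0 → sym (/-expand (n u) du*su≉0)) (limit-≉0 b≉0 ds→b))
    refl (limit-/ b≉0 ns→a ds→b)

  limit-u*u⁻¹ : Limit (λ u → u * u ⁻¹) 1#
  limit-u*u⁻¹ = limit-cong (eventually-map (λ u u≉0 → sym (*-inverse u≉0)) eventually-≉0)
    refl (limit-const 1#)

  module _ (x : Carrier) where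
    limit-x*u⁻¹ : Limit (λ u → x * u ⁻¹) 0#
    limit-x*u⁻¹ = limit-cong (always (λ _ → refl)) (zeroʳ x) (limit-* (limit-const x) limit-u⁻¹)

    -- Linear and quadratic forms n, divided by u and u².

    limit-linear : ∀ {n : Carrier → Carrier → Carrier} α γ →
      (∀ x y → n x y ≈ α * x + γ * y) → Limit (λ u → n x u * u ⁻¹) (n 0# 1#)
    limit-linear α γ n≈ = limit-cong
      (always (λ u → trans
        (solve 5 (λ α γ x u t → α :* (x :* t) :+ γ :* (u :* t) := (α :* x :+ γ :* u) :* t)
               refl α γ x u (u ⁻¹))
        (*-congʳ (sym (n≈ x u)))))
      (sym (n≈ 0# 1#))
      (limit-+ (limit-* (limit-const α) limit-x*u⁻¹) (limit-* (limit-const γ) limit-u*u⁻¹))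

    limit-quadratic : ∀ {n : Carrier → Carrier → Carrier} α β γ →
      (∀ x y → n x y ≈ α * (x * x) + β * (x * y) + γ * (y * y)) →
      Limit (λ u → n x u * (u ⁻¹ * u ⁻¹)) (n 0# 1#)
    limit-quadratic α β γ n≈ = limit-cong
      (always (λ u → trans
        (solve 6 (λ α β γ x u t →
            α :* ((x :* t) :* (x :* t)) :+ β :* ((x :* t) :* (u :* t)) :+ γ :* ((u :* t) :* (u :* t))
            := (α :* (x :* x) :+ β :* (x :* u) :+ γ :* (u :* u)) :* (t :* t))
          refl α β γ x u (u ⁻¹))
        (*-congʳ (sym (n≈ x u)))))
      (sym (n≈ 0# 1#))
      (limit-+ (limit-+
        (limit-* (limit-const α) (limit-* limit-x*u⁻¹ limit-x*u⁻¹))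
        (limit-* (limit-const β) (limit-* limit-x*u⁻¹ limit-u*u⁻¹)))
        (limit-* (limit-const γ) (limit-* limit-u*u⁻¹ limit-u*u⁻¹)))

    -- Quotients by the denominators of the weights.

    over-d : ∀ {n : Carrier → Carrier → Carrier} α γ →
      (∀ x y → n x y ≈ α * x + γ * y) →
      Limit (λ u → n x u / (x - q ^ 2 * u)) (n 0# 1# / (0# - q ^ 2 * 1#))
    over-d α γ n≈ = limit-fraction _⁻¹ d∞≉0 (limit-linear α γ n≈)
      (limit-linear {λ x y → x - q ^ 2 * y} 1# (- q ^ 2)
        (λ x y → solve 3 (λ q x y → x :- q :^ 2 :* y := 𝟙 :* x :+ :- q :^ 2 :* y) refl q x y))

    over-D : ∀ {n : Carrier → Carrier → Carrier} α β γ →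
      (∀ x y → n x y ≈ α * (x * x) + β * (x * y) + γ * (y * y)) →
      Limit (λ u → n x u / ((x - q ^ 2 * u) * (x - q ^ 3 * u)))
            (n 0# 1# / ((0# - q ^ 2 * 1#) * (0# - q ^ 3 * 1#)))
    over-D α β γ n≈ = limit-fraction (λ u → u ⁻¹ * u ⁻¹) D∞≉0 (limit-quadratic α β γ n≈)
      (limit-quadratic {λ x y → (x - q ^ 2 * y) * (x - q ^ 3 * y)} 1# (- (q ^ 2 + q ^ 3)) (q ^ 5)
        (λ x y → solve 3 (λ q x y → (x :- q :^ 2 :* y) :* (x :- q :^ 3 :* y) :=
            𝟙 :* (x :* x) :+ :- (q :^ 2 :+ q :^ 3) :* (x :* y) :+ q :^ 5 :* (y :* y)) refl q x y))

    -- Numerators and denominators are forms of the same degree in (x , y), so the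
    -- limit is the value at (0 , 1).
    limit-W : ∀ i j k l → Limit (λ u → W x u i j k l) (W 0# 1# i j k l)
    limit-W i j k l = go (toℕ i ℕ.+ toℕ j ℕ.≟ toℕ k ℕ.+ toℕ l)
      where
      w1010 : Limit (λ u → q ^ 2 * (x - u) / (x - q ^ 2 * u)) _
      w1010 = over-d _ _ (λ x y → solve 3 (λ q x y →
        q :^ 2 :* (x :- y) := q :^ 2 :* x :+ :- q :^ 2 :* y) refl q x y)
      w1001 : Limit (λ u → (1# - q ^ 2) * x / (x - q ^ 2 * u)) _
      w1001 = over-d {λ x y → (1# - q ^ 2) * x} _ _ (λ x y → solve 3 (λ q x y →
        (𝟙 :- q :^ 2) :* x := (𝟙 :- q :^ 2) :* x :+ 𝟘 :* y) refl q x y)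
      w0110 : Limit (λ u → (1# - q ^ 2) * u / (x - q ^ 2 * u)) _
      w0110 = over-d {λ x y → (1# - q ^ 2) * y} _ _ (λ x y → solve 3 (λ q x y →
        (𝟙 :- q :^ 2) :* y := 𝟘 :* x :+ (𝟙 :- q :^ 2) :* y) refl q x y)
      w0101 : Limit (λ u → (x - u) / (x - q ^ 2 * u)) _
      w0101 = over-d _ _ (λ x y → solve 2 (λ x y → x :- y := 𝟙 :* x :+ :- 𝟙 :* y) refl x y)

      conserving : ∀ i j k l → toℕ i ℕ.+ toℕ j ≡ toℕ k ℕ.+ toℕ l →
                   Limit (λ u → W x u i j k l) (W 0# 1# i j k l)
      conserving 0F 0F 0F 0F _ = limit-const 1#
      conserving 2F 2F 2F 2F _ = limit-const 1#
      conserving 1F 0F 1F 0F _ = w1010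
      conserving 2F 1F 2F 1F _ = w1010
      conserving 1F 0F 0F 1F _ = w1001
      conserving 2F 1F 1F 2F _ = w1001
      conserving 0F 1F 1F 0F _ = w0110
      conserving 1F 2F 2F 1F _ = w0110
      conserving 0F 1F 0F 1F _ = w0101
      conserving 1F 2F 1F 2F _ = w0101
      conserving 2F 0F 2F 0F _ = over-D _ _ _ (λ x y → solve 3 (λ q x y →
        q :^ 4 :* (x :- y) :* (x :- q :* y)
        := q :^ 4 :* (x :* x) :+ :- (q :^ 4 :+ q :^ 5) :* (x :* y) :+ q :^ 5 :* (y :* y))
        refl q x y)
      conserving 2F 0F 1F 1F _ = over-D _ _ _ (λ x y → solve 3 (λ q x y →
        :- (q :* (𝟙 :- q) :^ 2 :* (𝟙 :+ q) :* x :* (x :- y))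
        := :- (q :* (𝟙 :- q) :^ 2 :* (𝟙 :+ q)) :* (x :* x)
           :+ (q :* (𝟙 :- q) :^ 2 :* (𝟙 :+ q)) :* (x :* y) :+ 𝟘 :* (y :* y))
        refl q x y)
      conserving 2F 0F 0F 2F _ = over-D _ _ _ (λ x y → solve 3 (λ q x y →
        (𝟙 :- q :^ 2) :* x :* (x :+ q :* x :- q :* y :- q :^ 3 :* y)
        := (𝟙 :- q :^ 2) :* (𝟙 :+ q) :* (x :* x)
           :+ :- ((𝟙 :- q :^ 2) :* (q :+ q :^ 3)) :* (x :* y) :+ 𝟘 :* (y :* y))
        refl q x y)
      conserving 1F 1F 2F 0F _ = over-D _ _ _ (λ x y → solve 3 (λ q x y →
        :- (q :^ 4 :* (𝟙 :+ q) :* (x :- y) :* y)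
        := 𝟘 :* (x :* x) :+ :- (q :^ 4 :* (𝟙 :+ q)) :* (x :* y)
           :+ q :^ 4 :* (𝟙 :+ q) :* (y :* y))
        refl q x y)
      conserving 1F 1F 1F 1F _ = over-D _ _ _ (λ x y → solve 3 (λ q x y →
        :- (q :* x :^ 2) :+ (𝟙 :+ q) :* (𝟙 :- q :^ 2 :+ q :^ 4) :* x :* y :- q :^ 4 :* y :^ 2
        := :- q :* (x :* x) :+ (𝟙 :+ q) :* (𝟙 :- q :^ 2 :+ q :^ 4) :* (x :* y)
           :+ :- q :^ 4 :* (y :* y))
        refl q x y)
      conserving 1F 1F 0F 2F _ = over-D _ _ _ (λ x y → solve 3 (λ q x y →
        (𝟙 :+ q) :* x :* (x :- y)
        := (𝟙 :+ q) :* (x :* x) :+ :- (𝟙 :+ q) :* (x :* y) :+ 𝟘 :* (y :* y))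
        refl q x y)
      conserving 0F 2F 2F 0F _ = over-D _ _ _ (λ x y → solve 3 (λ q x y →
        (𝟙 :- q :^ 2) :* (x :+ q :^ 2 :* x :- q :^ 2 :* y :- q :^ 3 :* y) :* y
        := 𝟘 :* (x :* x) :+ (𝟙 :- q :^ 2) :* (𝟙 :+ q :^ 2) :* (x :* y)
           :+ :- ((𝟙 :- q :^ 2) :* (q :^ 2 :+ q :^ 3)) :* (y :* y))
        refl q x y)
      conserving 0F 2F 1F 1F _ = over-D _ _ _ (λ x y → solve 3 (λ q x y →
        q :* (𝟙 :- q) :^ 2 :* (𝟙 :+ q) :* (x :- y) :* y
        := 𝟘 :* (x :* x) :+ q :* (𝟙 :- q) :^ 2 :* (𝟙 :+ q) :* (x :* y)
           :+ :- (q :* (𝟙 :- q) :^ 2 :* (𝟙 :+ q)) :* (y :* y))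
        refl q x y)
      conserving 0F 2F 0F 2F _ = over-D _ _ _ (λ x y → solve 3 (λ q x y →
        (x :- y) :* (x :- q :* y)
        := 𝟙 :* (x :* x) :+ :- (𝟙 :+ q) :* (x :* y) :+ q :* (y :* y))
        refl q x y)
      conserving 1F 2F 0F 0F ()
      conserving 1F 2F 0F 1F ()
      conserving 1F 2F 0F 2F ()
      conserving 1F 2F 1F 0F ()
      conserving 1F 2F 1F 1F ()
      conserving 1F 2F 2F 0F ()
      conserving 1F 2F 2F 2F ()
      conserving 2F 1F 0F 0F ()
      conserving 2F 1F 0F 1F ()
      conserving 2F 1F 0F 2F ()
      conserving 2F 1F 1F 0F ()
      conserving 2F 1F 1F 1F ()
      conserving 2F 1F 2F 0F ()
      conserving 2F 1F 2F 2F ()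
      conserving 2F 2F 0F 0F ()
      conserving 2F 2F 0F 1F ()
      conserving 2F 2F 0F 2F ()
      conserving 2F 2F 1F 0F ()
      conserving 2F 2F 1F 1F ()
      conserving 2F 2F 1F 2F ()
      conserving 2F 2F 2F 0F ()
      conserving 2F 2F 2F 1F ()

      go : Dec (toℕ i ℕ.+ toℕ j ≡ toℕ k ℕ.+ toℕ l) →
           Limit (λ u → W x u i j k l) (W 0# 1# i j k l)
      go (yes p) = conserving i j k l p
      go (no  p) = limit-cong (always (λ u → sym (ice i j k l p))) (sym (ice i j k l p))
        (limit-const 0#)

  iterated-∑ : ∀ {n a} {A : Set a} (as : List A) {f : A → Vec Carrier n → Carrier} {g : A → Carrier} →
    (∀ a → IteratedLimit n (f a) (g a)) → IteratedLimit n (λ u → ∑ as (λ a → f a u)) (∑ as g)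
  iterated-∑ List.[]       lim = iterated-const _ 0#
  iterated-∑ (a List.∷ as) lim = iterated-+ (lim a) (iterated-∑ as lim)

  iterated-∏ : ∀ {n k} {f : Fin k → Vec Carrier n → Carrier} {g : Fin k → Carrier} →
    (∀ r → IteratedLimit n (f r) (g r)) → IteratedLimit n (λ u → ∏ (λ r → f r u)) (∏ g)
  iterated-∏ {k = zero}  lim = iterated-const _ 1#
  iterated-∏ {k = suc k} lim = iterated-* (lim fzero) (iterated-∏ (lim ∘ fsuc))

  iterated-W : ∀ n k z x i j k′ l → IteratedLimit n
    (λ u → W x ((u ∪ z) k) i j k′ l) ((infinities n ∪ finite ∘ z) k x i j k′ l)
  iterated-W zero    k       z x i j k′ l = iterated-const 0 _
  iterated-W (suc n) zero    z x i j k′ l =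
    (λ u → W x u i j k′ l) , always (λ u → iterated-const n _) , limit-W x i j k′ l
  iterated-W (suc n) (suc k) z x i j k′ l =
    (λ _ → (infinities n ∪ finite ∘ z) k x i j k′ l) ,
    always (λ _ → iterated-W n k z x i j k′ l) , limit-const _

  iterated-F : ∀ {N} n S (x : Vec Carrier N) z → IteratedLimit n
    (λ u → F S x (u ∪ z))
    (partition (prefix (bound S) (entry S)) (infinities n ∪ finite ∘ z) x (twos N))
  iterated-F {N} n S x z = iterated-cong (λ u → sym (Fᴵ≈partition (twos N) S x (u ∪ z))) refl
    (iterated-∑ (List.filter (hasBoundary? (twos N) (prefix (bound S) (entry S)))
                             (configurations N (bound S)))
      (λ (h , v) → iterated-∏ {k = N} (λ r → iterated-∏ {k = bound S} (λ k →
        iterated-W n (toℕ k) z (lookup x r)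
          (lookup (lookup v (inject₁ r)) k) (lookup (lookup h r) (inject₁ k))
          (lookup (lookup v (fsuc r)) k) (lookup (lookup h r) (fsuc k))))))

  iterated-F/F : (∀ k → q ^ suc k ≉ 1#) → ∀ {N} n K → n ℕ.+ K ≡ N →
    ∀ S (x : Vec Carrier N) z w →
    IteratedLimit n (λ u → F (2^ n ∪ S) x (u ∪ z) / F {n} (2^ n ∪ ∅) w (u ∪ z)) (H K S x z)
  iterated-F/F qᵏ≉1 {N} n K n+K≡N S x z w = iterated-cong (λ _ → refl)
    (/-unique C≉0 (*-comm _ _))
    (iterated-/ C≉0
      (iterated-cong (λ _ → refl) (partition-infinities n K S x z n+K≡N) (iterated-F n (2^ n ∪ S) x z))
      (iterated-cong (λ _ → refl) denominator (iterated-F n (2^ n ∪ ∅) w z)))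
    where
    C≉0 : norm n 1 ≉ 0#
    C≉0 = norm≉0 qᵏ≉1 n 0
    denominator : partition (prefix (bound (2^ n ∪ ∅)) (entry (2^ n ∪ ∅))) (infinities n ∪ finite ∘ z) w (twos n)
                  ≈ norm n 1
    denominator = trans (partition-infinities n 0 ∅ w z (ℕ.+-identityʳ n))
      (trans (*-congˡ (H-∅ w z)) (*-identityʳ _))

open import Data.Nat using (ℕ; _<_; _∸_; _*_)

theorem1p7p2 : ∀ {c ℓ r ρ₁ ρ₂ : Level} (V : ValuedField c ℓ r ρ₁ ρ₂) →
    let open ValuedField V using (Carrier) in
    let open ValuedField V using (scalars) in
    let open ValuedField V using (_/_) in
    let open Limits V in
    (q : Carrier) →
    let open IzerginKorepin scalars q in
    (K N : ℕ) → K < N →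
    (S : TwoString) → ∣ S ∣ₛ ≡ 2 * K →
    (x : Vec Carrier N) (z : ℕ → Carrier) → Generic x z →
    (w : Vec Carrier (N ∸ K)) →
    IteratedLimit (N ∸ K)
    (λ u → F (2^ (N ∸ K) ∪ S) x (u ∪ z) / F (2^ (N ∸ K) ∪ ∅) w (u ∪ z))
    (H K S x z)
theorem1p7p2 V q K N K<N S ∣S∣≡2K x z generic w =
  LimitOfF.iterated-F/F V q q≉0 qᵏ≉1 (N ∸ K) K (ℕ.m∸n+n≡m (ℕ.<⇒≤ K<N)) S x z w
  where
  open ValuedField V using (scalars)
  open IzerginKorepin scalars q
  open Generic generic
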